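{- Let $n,p,r$ be integers with $1\le p\le n$ and $1\le r\le n-p+1$. Then $|\mathcal{T}_n^{(r,p)}|=\Delta^{r-1}\big(B_{n-p+1-r,p}\big)$, where the forward difference operator $\Delta$ acts on the first index, i.e. $\Delta^{m}(B_{a,k})=\sum_{j=0}^{m}(-1)^{m-j}\binom{m}{j}B_{a+j,k}$.
   Context: Sites $L_n=\{0,1,\dots,n+1\}$. For $\pi=\pi_1\cdots\pi_n\in S_n$, $r\in[n+1]$ and $1\le p\le n$, the configuration $\pi^{(r,p)}$ of $n+1$ labeled chips is obtained by placing on site $i$ ($1\le i\le n$) the chip $\pi_i$ if $\pi_i<r$ and $\pi_i+1$ if $\pi_i\ge r$, and additionally placing the chip $r$ on site $p$ (so site $p$ holds two chips). Toppling: while some site holds at least two chips, choose such a site $i$, choose two chips $\alpha<\beta$ there, and move $\alpha$ to site $i-1$ and $\beta$ to site $i+1$. The final configuration is independent of choices and has one chip on every site but one; reading chips left to right gives a permutation of $[n+1]$. $\pi$ is $(r,p)$-toppleable if the final permutation from $\pi^{(r,p)}$ is the identity; $\mathcal{T}_n^{(r,p)}$ is the set of $(r,p)$-toppleable permutations in $S_n$. Poly-Bernoulli numbers of type B: $\sum_{n\ge0}B_{n,k}\frac{x^n}{n!}=\frac{\mathrm{Li}_{ -k}(1-e^{ -x})}{1-e^{ -x}}$ with $\mathrm{Li}_s(z)=\sum_{i\ge1}z^i/i^s$. -}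

module Defs where

open import Data.Bool using (Bool; true; false; not; _∧_; if_then_else_)
open import Data.Nat as ℕ using (ℕ; zero; suc; _∸_; _!; _<ᵇ_; _≡ᵇ_; _⊓_)
open import Data.Nat.Properties using (_!≢0)
open import Data.Nat.Combinatorics using (_C_)
open import Data.Integer as ℤ using (ℤ; +_)
open import Data.Rational as ℚ using (ℚ; 0ℚ; 1ℚ; _/_)
open import Data.Fin using (Fin; toℕ)
open import Data.Vec using (Vec; toList)
open import Data.Bool.ListAction using (any)
open import Data.List using (List; []; _∷_; map; filter; length; foldr; concatMap; zip; upTo)
open import Data.List.Properties using (≡-dec)
open import Data.Product using (_×_; _,_; proj₁; proj₂)
open import Data.Maybe using (Maybe; just; nothing)
open import Relation.Nullary.Decidable using (⌊_⌋)
import Data.Integer.Properties as ℤP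
import Data.Nat.Properties as ℕP

-- Permutations of [n]: words π₁…πₙ (letters in Fin n, read as 1..n)
-- with pairwise distinct letters.

distinct : List ℕ → Bool
distinct []       = true
distinct (x ∷ xs) = not (any (x ≡ᵇ_) xs) ∧ distinct xs

isPerm : ∀ {n} → Vec (Fin n) n → Bool
isPerm π = distinct (map toℕ (toList π))

-- Chip configurations: a list of (chip label, site) pairs.

Config : Set
Config = List (ℕ × ℤ)

initConfig : ∀ {n} → ℕ → ℕ → Vec (Fin n) n → Config
initConfig {n} r p π =
  (r , + p) ∷ map (λ iv → (lab (suc (toℕ (proj₂ iv))) , + proj₁ iv))
                  (zip (map suc (upTo n)) (toList π))
  where
  lab : ℕ → ℕ
  lab v = if v <ᵇ r then v else suc v

chipsAt : ℤ → Config → List ℕ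
chipsAt s c = map proj₁ (filter (λ x → proj₂ x ℤP.≟ s) c)

hotSites : Config → List ℤ
hotSites c = filter (λ s → 2 ℕP.≤? length (chipsAt s c)) (map proj₂ c)

minℕ : List ℕ → ℕ
minℕ []       = 0
minℕ (x ∷ xs) = foldr _⊓_ x xs

-- One toppling step (deterministic choice: leftmost site with ≥ 2 chips,
-- and the two smallest chips α < β there); nothing if stable.
step : Config → Maybe Config
step c with hotSites c
... | []     = nothing
... | h ∷ hs = just (map move c)
  where
  s : ℤ
  s = foldr ℤ._⊓_ h hs
  ls : List ℕ
  ls = chipsAt s c
  α β : ℕ
  α = minℕ ls
  β = minℕ (filter (λ x → α ℕ.<? x) ls)
  move : ℕ × ℤ → ℕ × ℤ
  move (x , t) = if (x ≡ᵇ α) ∧ ⌊ t ℤP.≟ s ⌋ then (x , s ℤ.- + 1)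
                 else if (x ≡ᵇ β) ∧ ⌊ t ℤP.≟ s ⌋ then (x , s ℤ.+ + 1)
                 else (x , t)

run : ℕ → Config → Config
run zero    c = c
run (suc f) c with step c
... | nothing = c
... | just c' = run f c'

isStable : Config → Bool
isStable c with hotSites c
... | []    = true
... | _ ∷ _ = false

reading : ℕ → Config → List ℕ
reading n c = concatMap (λ s → chipsAt (+ s) c) (upTo (suc (suc n)))

idList : ℕ → List ℕ
idList n = map suc (upTo (suc n))

-- fuel: each topple raises Σ (site)² by 2, and with all n+1 chips on
-- L_n this sum is ≤ (n+1)³, so (n+2)³ steps suffice to stabilise.
fuel : ℕ → ℕ
fuel n = suc (suc n) ℕ.* suc (suc n) ℕ.* suc (suc n)

finalConfig : ∀ {n} → ℕ → ℕ → Vec (Fin n) n → Config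
finalConfig {n} r p π = run (fuel n) (initConfig r p π)

toppleable : ∀ {n} → ℕ → ℕ → Vec (Fin n) n → Bool
toppleable {n} r p π =
  isStable (finalConfig r p π) ∧
  ⌊ ≡-dec ℕP._≟_ (reading n (finalConfig r p π)) (idList n) ⌋

Series : Set
Series = ℕ → ℚ

sumTo : ℕ → (ℕ → ℚ) → ℚ
sumTo zero    f = f 0
sumTo (suc n) f = sumTo n f ℚ.+ f (suc n)

oneS : Series
oneS zero    = 1ℚ
oneS (suc _) = 0ℚ

mulS : Series → Series → Series
mulS f g n = sumTo n (λ j → f j ℚ.* g (n ∸ j))

powS : Series → ℕ → Series
powS f zero    = oneS
powS f (suc k) = mulS f (powS f k)

signℚ : ℕ → ℚ
signℚ zero    = 1ℚ
signℚ (suc m) = ℚ.- signℚ m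

expNeg : Series
expNeg n = signℚ n ℚ.* ((+ 1 / (n !)) {{n !≢0}})

oneMinusExpNeg : Series
oneMinusExpNeg n = oneS n ℚ.- expNeg n

ℕtoℚ : ℕ → ℚ
ℕtoℚ m = + m / 1

-- Li_{-k}(z)/z = Σ_{i≥1} i^k z^{i-1}, composed with z = 1 - e^{-x}.
-- As z has zero constant term, only i ≤ n+1 contribute to x^n.
polyBGen : ℕ → Series
polyBGen k n = sumTo n (λ i → ℕtoℚ (suc i ℕ.^ k) ℚ.* powS oneMinusExpNeg i n)

-- B_{n,k} = n! [x^n] Li_{-k}(1-e^{-x})/(1-e^{-x})
B : ℕ → ℕ → ℚ
B n k = ℕtoℚ (n !) ℚ.* polyBGen k n

ΔB : ℕ → ℕ → ℕ → ℚ
ΔB m a k = sumTo m (λ j → signℚ (m ∸ j) ℚ.* ℕtoℚ (m C j) ℚ.* B (a ℕ.+ j) k)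

-- Toppling the leftmost hot site first, the chip r and the chips to the right of site p are fed
-- one after another into a window of p chips, and each time the smallest chip leaves to the left:
-- the topplings are the comparators of a grid.  The outputs are 1, 2, … in order iff every input
-- is large enough; evaluating the grid by columns instead, the window ends sorted iff its initial
-- chips are small enough.  Hence toppleability bounds each letter of π separately, and the number
-- of toppleable permutations is the permanent of a matrix whose rows are [w < t] or 1 − [w < t].
-- Expanding the rows of the second kind leaves nested thresholds, which are counted greedily.
-- Treating one such row acts on i ↦ (i + 1)ᵖ by the operator 𝒜 or by 𝒜 − 1, according to whether
-- its index is at least r.  As E = 1 − e⁻ˣ satisfies E′ = 1 − E, the operator 𝒜 also computes
-- B_{n,p} as (𝒜ⁿ f)(0) with f(i) = (i + 1)ᵖ, and then 𝒜 − 1 is the forward difference.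
module Submission where

open import Defs
open import Axiom.UniquenessOfIdentityProofs.WithK using (uip)
open import Data.Bool using (Bool; true; false; not; _∧_; if_then_else_)
open import Data.Bool.ListAction using (any)
open import Data.Bool.Properties using (T-≡)
open import Data.Empty using (⊥-elim)
open import Data.Fin using (Fin; toℕ) renaming (zero to fzero; suc to fsuc)
open import Data.Fin.Properties using (+↔⊎; toℕ<n)
open import Data.Integer as ℤ using (ℤ)
import Data.Integer.Properties as ℤP
open import Data.List using (List; []; _∷_; [_]; _++_; _ʳ++_; map; filter; length; foldr; concat; drop; upTo; downFrom; applyUpTo; applyDownFrom; iterate; replicate; reverse; zip)
open import Data.List.Properties as List using (∷-injective; ≡-dec; filter-accept; filter-reject; filter-all; filter-none; filter-++; length-++; length-map; length-ʳ++; length-upTo; length-applyUpTo; length-applyDownFrom; map-++; map-∘; map-cong; map-id-local; map-upTo; map-downFrom; map-applyUpTo; map-ʳ++; ++-assoc; ++-ʳ++; ʳ++-ʳ++; reverse-injective; reverse-applyDownFrom)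
open import Data.List.Membership.Propositional using (_∈_)
open import Data.List.Membership.Propositional.Properties using (∈-map⁺; ∈-map⁻; ∈-filter⁺; ∈-filter⁻; ∈-++⁻; ∈-++⁺ʳ; ∈-∃++; ∈-applyUpTo⁺; ∈-upTo⁺; ∈-upTo⁻)
open import Data.List.Relation.Binary.Permutation.Propositional
open import Data.List.Relation.Binary.Permutation.Propositional.Properties using (map⁺; ↭-length; shift; filter-↭; ∈-resp-↭; drop-∷; ↭-empty-inv; ↭-singleton-inv; ++⁺ˡ; ++⁺ʳ; ++-comm; ++↭ʳ++; ↭-reverse)
import Data.List.Relation.Binary.Permutation.Setoid.Properties as PermutationSetoid
open import Data.List.Relation.Binary.Pointwise as Pointwise using (Pointwise; []; _∷_)
open import Data.List.Relation.Unary.All using (All; []; _∷_; tabulate; lookup; universal)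
import Data.List.Relation.Unary.All.Properties as All
open import Data.List.Relation.Unary.AllPairs using (AllPairs; []; _∷_)
open import Data.List.Relation.Unary.AllPairs.Properties using (applyUpTo⁺₁; applyDownFrom⁺₁)
open import Data.List.Relation.Unary.Any using (here; there)
open import Data.List.Relation.Unary.Unique.Propositional using (Unique)
import Data.List.Relation.Unary.Unique.Propositional.Properties as Unique
open import Data.Maybe using (just; nothing)
open import Data.Nat as ℕ using (ℕ; zero; suc; _≤_; _<_; _≥_; z≤n; s≤s; s≤s⁻¹; _∸_; _⊓_; _⊔_; _!; _^_; _<ᵇ_; _≡ᵇ_; _≟_; _<?_; _≤?_)
open import Data.Nat.Combinatorics using (_C_; nCk+nC[k+1]≡[n+1]C[k+1]; k>n⇒nCk≡0)
open import Data.Nat.GeneralisedArithmetic using (fold)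
import Data.Nat.Properties as ℕP
open import Data.Product using (Σ; Σ-syntax; ∃; ∃₂; _×_; _,_; proj₁; proj₂)
open import Data.Rational using (ℚ; 0ℚ; 1ℚ; _/_; toℚᵘ)
open import Data.Rational.Properties as ℚP using (toℚᵘ-injective; toℚᵘ-homo-+; toℚᵘ-homo-*; toℚᵘ-fromℚᵘ)
open import Data.Rational.Solver using (module +-*-Solver)
import Data.Rational.Unnormalised as ℚᵘ
import Data.Rational.Unnormalised.Properties as ℚᵘP
open import Data.Sum using (_⊎_; inj₁; inj₂)
open import Data.Sum.Function.Propositional using (_⊎-↔_)
open import Data.Vec using (Vec; []; _∷_; toList)
open import Data.Vec.Properties using (length-toList)
open import Function using (_∘_; const; flip; _↔_; mk↔ₛ′; _⇔_; mk⇔; Equivalence)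
open import Function.Construct.Composition using (_↔-∘_)
open import Function.Construct.Symmetry using (↔-sym)
open import Relation.Binary.Definitions using (tri<; tri≈; tri>)
open import Relation.Binary.PropositionalEquality as ≡ using (_≡_; _≢_; _≗_; refl; sym; cong; cong₂; subst; setoid; module ≡-Reasoning)
open import Relation.Nullary using (¬_; ¬?; Dec; yes; no)
open import Relation.Nullary.Decidable using (⌊_⌋)
open +-*-Solver using (solve; _:=_; _:+_; _:*_; _:-_; :-_)
open Equivalence using (to; from)

-- The obstacle to a criterion letter by letter is that inserting the chip `r` renames every letter
-- from `r` upwards, so a bound on chips becomes a bound on letters that may depend on `r`. The
-- hypothesis r ≤ n - p + 1 confines this dependence to the sites right of p. Put m = n - p and
-- count letters from 0: site i ≤ p demands a letter below m + i, whatever `r` is, while the k-th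
-- site after p (k from 0) demands a letter at least k + 1 if k < r - 1, and at least k otherwise.
-- The thresholds 1, ..., r - 1, then r - 1, ..., m - 1, then m + 1, ..., n are nondecreasing, as
-- greedy counting requires. When k rows have been treated and i of them postponed, k - i small
-- letters are used up; so threshold k leaves i admissible letters and threshold k + 1 leaves i + 1.
-- This single unit is the difference between `𝒜` and `𝒜` - 1. Each of the p window rows offers i +
-- 1 letters, whence (i + 1)ᵖ, and the i postponed free rows contribute i!. At the start nothing is
-- postponed, whence the evaluation at 0.

-- Boolean tests and the propositions they decide.

module Booleans where
  open ℕP

  ≢-true⇒false : ∀ {b} → b ≢ true → b ≡ false
  ≢-true⇒false {true}  h = ⊥-elim (h refl)
  ≢-true⇒false {false} h = refl

  bool-ext : ∀ {a b} → (a ≡ true → b ≡ true) → (b ≡ true → a ≡ true) → a ≡ b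
  bool-ext {true}          f g = sym (f refl)
  bool-ext {false} {true}  f g = g refl
  bool-ext {false} {false} f g = refl

  ∧-true : ∀ {a b} → a ∧ b ≡ true → a ≡ true × b ≡ true
  ∧-true {true} {true} refl = refl , refl

  <ᵇ-true : ∀ {a b} → (a <ᵇ b) ≡ true ⇔ a < b
  <ᵇ-true {a} {b} = mk⇔ (<ᵇ⇒< a b ∘ from T-≡) (to T-≡ ∘ <⇒<ᵇ)

  <ᵇ-false : ∀ {a b} → not (a <ᵇ b) ≡ true ⇔ b ≤ a
  <ᵇ-false {a} {b} = mk⇔ ⇒ (λ b≤a → cong not (≢-true⇒false (≤⇒≯ b≤a ∘ to <ᵇ-true)))
    where
    ⇒ : not (a <ᵇ b) ≡ true → b ≤ a
    ⇒ h with a <? b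
    ... | no a≮b = ≮⇒≥ a≮b
    ... | yes a<b with () ← ≡.trans (sym h) (cong not (from <ᵇ-true a<b))

  <ᵇ-yes : ∀ {a b} → a < b → (a <ᵇ b) ≡ true
  <ᵇ-yes = from <ᵇ-true

  <ᵇ-no : ∀ {a b} → ¬ a < b → (a <ᵇ b) ≡ false
  <ᵇ-no a≮b = ≢-true⇒false (a≮b ∘ to <ᵇ-true)

  <ᵇ-case : ∀ a b → (a < b × (a <ᵇ b) ≡ true) ⊎ (b ≤ a × (a <ᵇ b) ≡ false)
  <ᵇ-case a b with a <? b
  ... | yes a<b = inj₁ (a<b , <ᵇ-yes a<b)
  ... | no  a≮b = inj₂ (≮⇒≥ a≮b , <ᵇ-no a≮b)

  ≡ᵇ-true : ∀ {x y} → (x ≡ᵇ y) ≡ true ⇔ x ≡ y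
  ≡ᵇ-true {x} {y} = mk⇔ (≡ᵇ⇒≡ x y ∘ from T-≡) (to T-≡ ∘ ≡⇒≡ᵇ x y)

  ≡ᵇ-refl : ∀ x → (x ≡ᵇ x) ≡ true
  ≡ᵇ-refl x = from (≡ᵇ-true {x}) refl

  ≢⇒≡ᵇ : ∀ {x y} → x ≢ y → (x ≡ᵇ y) ≡ false
  ≢⇒≡ᵇ x≢y = ≢-true⇒false (x≢y ∘ to ≡ᵇ-true)

  isYes-true : ∀ {P : Set} {P? : Dec P} → ⌊ P? ⌋ ≡ true ⇔ P
  isYes-true {P? = yes p} = mk⇔ (λ _ → p) (λ _ → refl)
  isYes-true {P? = no ¬p} = mk⇔ (λ ()) (λ p → ⊥-elim (¬p p))

open Booleans

-- The toppling process as a network of comparators.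

module ChipFiring where
  open import Data.Integer using (+_)
  open import Data.Nat using (_+_; _*_)
  open ℕP

  -- A line lists the chips of the sites 0, 1, …; in L ʳ++ R the sites of L run leftwards from R.
  Line : Set
  Line = List (List ℕ)

  put : ℕ → List ℕ → Config
  put i = map (λ x → (x , + i))

  place : ℕ → Line → Config
  place i []        = []
  place i (xs ∷ ls) = put i xs ++ place (suc i) ls

  nth : Line → ℕ → List ℕ
  nth []        _       = []
  nth (xs ∷ ls) zero    = xs
  nth (xs ∷ ls) (suc u) = nth ls u

  Short : List ℕ → Set
  Short xs = length xs ≤ 1

  at? : (s : ℤ) (ch : ℕ × ℤ) → Dec (proj₂ ch ≡ s)
  at? s ch = proj₂ ch ℤP.≟ s

  chipsAt-++ : ∀ s c d → chipsAt s (c ++ d) ≡ chipsAt s c ++ chipsAt s d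
  chipsAt-++ s c d = ≡.trans (cong (map proj₁) (filter-++ (at? s) c d)) (map-++ proj₁ (filter (at? s) c) _)

  chipsAt-↭ : ∀ s {c d} → c ↭ d → chipsAt s c ↭ chipsAt s d
  chipsAt-↭ s p = map⁺ proj₁ (filter-↭ (at? s) p)

  chipsAt-∷-≡ : ∀ s x c → chipsAt s ((x , s) ∷ c) ≡ x ∷ chipsAt s c
  chipsAt-∷-≡ s x c = cong (map proj₁) (filter-accept (at? s) refl)

  chipsAt-∷-≢ : ∀ {s t} x c → t ≢ s → chipsAt s ((x , t) ∷ c) ≡ chipsAt s c
  chipsAt-∷-≢ {s} x c t≢s = cong (map proj₁) (filter-reject (at? s) t≢s)

  chipsAt-put-≡ : ∀ i xs → chipsAt (+ i) (put i xs) ≡ xs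
  chipsAt-put-≡ i []       = refl
  chipsAt-put-≡ i (x ∷ xs) = ≡.trans (chipsAt-∷-≡ (+ i) x (put i xs)) (cong (x ∷_) (chipsAt-put-≡ i xs))

  chipsAt-put-≢ : ∀ {i u} xs → i ≢ u → chipsAt (+ u) (put i xs) ≡ []
  chipsAt-put-≢         []       i≢u = refl
  chipsAt-put-≢ {i} {u} (x ∷ xs) i≢u =
    ≡.trans (chipsAt-∷-≢ x (put i xs) (i≢u ∘ ℤP.+-injective)) (chipsAt-put-≢ xs i≢u)

  chipsAt-place-< : ∀ {i u} ls → u < i → chipsAt (+ u) (place i ls) ≡ []
  chipsAt-place-< []        u<i = refl
  chipsAt-place-< {i} {u} (xs ∷ ls) u<i = begin
    chipsAt (+ u) (put i xs ++ place (suc i) ls)                  ≡⟨ chipsAt-++ (+ u) (put i xs) _ ⟩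
    chipsAt (+ u) (put i xs) ++ chipsAt (+ u) (place (suc i) ls)  ≡⟨ cong₂ _++_ (chipsAt-put-≢ xs (<⇒≢ u<i ∘ sym)) (chipsAt-place-< ls (m<n⇒m<1+n u<i)) ⟩
    []                                                            ∎
    where open ≡-Reasoning

  chipsAt-place : ∀ i ls u → chipsAt (+ (i + u)) (place i ls) ≡ nth ls u
  chipsAt-place i []        u       = refl
  chipsAt-place i (xs ∷ ls) zero    = begin
    chipsAt (+ (i + 0)) (put i xs ++ place (suc i) ls)              ≡⟨ cong (λ v → chipsAt (+ v) (put i xs ++ place (suc i) ls)) (+-identityʳ i) ⟩
    chipsAt (+ i) (put i xs ++ place (suc i) ls)                    ≡⟨ chipsAt-++ (+ i) (put i xs) _ ⟩
    chipsAt (+ i) (put i xs) ++ chipsAt (+ i) (place (suc i) ls)    ≡⟨ cong₂ _++_ (chipsAt-put-≡ i xs) (chipsAt-place-< ls (n<1+n i)) ⟩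
    xs ++ []                                                        ≡⟨ List.++-identityʳ xs ⟩
    xs                                                              ∎
    where open ≡-Reasoning
  chipsAt-place i (xs ∷ ls) (suc u) = begin
    chipsAt (+ (i + suc u)) (put i xs ++ place (suc i) ls)                            ≡⟨ chipsAt-++ (+ (i + suc u)) (put i xs) _ ⟩
    chipsAt (+ (i + suc u)) (put i xs) ++ chipsAt (+ (i + suc u)) (place (suc i) ls)  ≡⟨ cong₂ _++_ (chipsAt-put-≢ xs (<⇒≢ (m<m+n i (s≤s z≤n)))) (cong (λ v → chipsAt (+ v) (place (suc i) ls)) (+-suc i u)) ⟩
    chipsAt (+ (suc i + u)) (place (suc i) ls)                                        ≡⟨ chipsAt-place (suc i) ls u ⟩
    nth ls u                                                                          ∎
    where open ≡-Reasoning

  ∈-place⁻ : ∀ i ls {x t} → (x , t) ∈ place i ls → ∃ λ u → t ≡ + u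
  ∈-place⁻ i (xs ∷ ls) h with ∈-++⁻ (put i xs) h
  ... | inj₁ h₁ with ∈-map⁻ _ h₁
  ...   | _ , _ , refl = i , refl
  ∈-place⁻ i (xs ∷ ls) h | inj₂ h₂ = ∈-place⁻ (suc i) ls h₂

  ∈-chipsAt : ∀ {x t c} → (x , t) ∈ c → x ∈ chipsAt t c
  ∈-chipsAt {t = t} h = ∈-map⁺ proj₁ (∈-filter⁺ (at? t) h refl)

  -- The prefix is chosen before `R`, so the same one serves for the line with a given chip on site
  -- `length L` and for the line without it; `place-insert` compares these two.
  place-ʳ++ : ∀ L → ∃ λ pre → ∀ R → place 0 (L ʳ++ R) ≡ pre ++ place (length L) R
  place-ʳ++ []      = [] , λ R → refl
  place-ʳ++ (B ∷ L) with place-ʳ++ L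
  ... | pre , eq = pre ++ put (length L) B ,
    λ R → ≡.trans (eq (B ∷ R)) (sym (++-assoc pre (put (length L) B) _))

  place-insert : ∀ L x A R → place 0 (L ʳ++ ((x ∷ A) ∷ R)) ↭ (x , + length L) ∷ place 0 (L ʳ++ (A ∷ R))
  place-insert L x A R with place-ʳ++ L
  ... | pre , eq = ↭-trans (↭-reflexive (eq ((x ∷ A) ∷ R)))
    (↭-trans (shift (x , + length L) pre (put (length L) A ++ place (suc (length L)) R))
             (prep _ (↭-reflexive (sym (eq (A ∷ R))))))

  nth-ʳ++ : ∀ L R u → nth (L ʳ++ R) (length L + u) ≡ nth R u
  nth-ʳ++ []      R u = refl
  nth-ʳ++ (B ∷ L) R u = ≡.trans (cong (nth (L ʳ++ (B ∷ R))) (sym (+-suc (length L) u))) (nth-ʳ++ L (B ∷ R) (suc u))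

  nth-ʳ++-short : ∀ {L R u} → All Short L → u < length L → Short (nth (L ʳ++ R) u)
  nth-ʳ++-short {B ∷ L} {R} {u} (b ∷ bs) u<
    with m≤n⇒m<n∨m≡n (≤-pred u<)
  ... | inj₁ u<L  = nth-ʳ++-short bs u<L
  ... | inj₂ refl = subst Short (sym (≡.trans (cong (nth (L ʳ++ (B ∷ R))) (sym (+-identityʳ (length L)))) (nth-ʳ++ L (B ∷ R) 0))) b

  -- Restates the function `move` local to `step`, with the site and the two labels as free
  -- parameters.
  moveTo : ℤ → ℕ → ℕ → ℕ × ℤ → ℕ × ℤ
  moveTo s α β (x , t) = if (x ≡ᵇ α) ∧ ⌊ t ℤP.≟ s ⌋ then (x , s ℤ.- + 1)
                         else if (x ≡ᵇ β) ∧ ⌊ t ℤP.≟ s ⌋ then (x , s ℤ.+ + 1)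
                         else (x , t)

  secondSmallest : List ℕ → ℕ
  secondSmallest xs = minℕ (filter (λ x → minℕ xs <? x) xs)

  step-hot : ∀ c {h hs s x y} → hotSites c ≡ h ∷ hs → foldr ℤ._⊓_ h hs ≡ s →
             minℕ (chipsAt s c) ≡ x → secondSmallest (chipsAt s c) ≡ y →
             step c ≡ just (map (moveTo s x y) c)
  step-hot c eq refl refl refl with hotSites c | eq
  -- With the parameters identified, `move` and `moveTo` unfold to the same conditional on each
  -- chip.
  ... | h ∷ hs | refl = cong just (map-cong (λ _ → refl) c)

  step-stable : ∀ c → hotSites c ≡ [] → step c ≡ nothing
  step-stable c eq with hotSites c | eq
  ... | [] | refl = refl

  isStable-stable : ∀ c → hotSites c ≡ [] → isStable c ≡ true
  isStable-stable c eq with hotSites c | eq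
  ... | [] | refl = refl

  foldr-⊓-least : ∀ s h hs → s ∈ h ∷ hs → All (s ℤ.≤_) (h ∷ hs) → foldr ℤ._⊓_ h hs ≡ s
  foldr-⊓-least s h hs s∈ (s≤h ∷ s≤hs) = ℤP.≤-antisym (below s∈) (above s≤hs)
    where
    above : ∀ {ks} → All (s ℤ.≤_) ks → s ℤ.≤ foldr ℤ._⊓_ h ks
    above []           = s≤h
    above (s≤k ∷ s≤ks) = ℤP.⊓-glb s≤k (above s≤ks)
    start : ∀ ks → foldr ℤ._⊓_ h ks ℤ.≤ h
    start []       = ℤP.≤-refl
    start (k ∷ ks) = ℤP.≤-trans (ℤP.i⊓j≤j k _) (start ks)
    inside : ∀ {ks} → s ∈ ks → foldr ℤ._⊓_ h ks ℤ.≤ s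
    inside {k ∷ ks} (here refl) = ℤP.i⊓j≤i s _
    inside {k ∷ ks} (there h)   = ℤP.≤-trans (ℤP.i⊓j≤j k _) (inside h)
    below : s ∈ h ∷ hs → foldr ℤ._⊓_ h hs ℤ.≤ s
    below (here refl) = start hs
    below (there h)   = inside h

  ↭-pair : ∀ {xs : List ℕ} {x y} → xs ↭ x ∷ y ∷ [] → (xs ≡ x ∷ y ∷ []) ⊎ (xs ≡ y ∷ x ∷ [])
  ↭-pair {[]} p with ↭-length p
  ... | ()
  ↭-pair {a ∷ []} p with ↭-length p
  ... | ()
  ↭-pair {a ∷ b ∷ _ ∷ _} p with ↭-length p
  ... | ()
  ↭-pair {a ∷ b ∷ []} p with ∈-resp-↭ p (here refl)
  ... | here refl with ↭-singleton-inv (drop-∷ p)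
  ...   | refl = inj₁ refl
  ↭-pair {a ∷ b ∷ []} p | there (here refl) with ↭-singleton-inv (drop-∷ (↭-trans p (swap _ _ refl)))
  ...   | refl = inj₂ refl

  minℕ-pair : ∀ {xs x y} → x < y → xs ↭ x ∷ y ∷ [] → minℕ xs ≡ x
  minℕ-pair {x = x} {y} x<y p with ↭-pair p
  ... | inj₁ refl = m≥n⇒m⊓n≡n (<⇒≤ x<y)
  ... | inj₂ refl = m≤n⇒m⊓n≡m (<⇒≤ x<y)

  secondSmallest-pair : ∀ {xs x y} → x < y → xs ↭ x ∷ y ∷ [] → secondSmallest xs ≡ y
  secondSmallest-pair {xs} {x} {y} x<y p = begin
    minℕ (filter (minℕ xs <?_) xs)  ≡⟨ cong (λ z → minℕ (filter (z <?_) xs)) (minℕ-pair x<y p) ⟩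
    minℕ (filter (x <?_) xs)            ≡⟨ cong minℕ (↭-singleton-inv (↭-trans (filter-↭ (x <?_) p) (↭-reflexive only))) ⟩
    y                                   ∎
    where
    open ≡-Reasoning
    only : filter (x <?_) (x ∷ y ∷ []) ≡ y ∷ []
    only = ≡.trans (filter-reject (x <?_) (<-irrefl refl)) (filter-accept (x <?_) x<y)

  moveTo-small : ∀ s x y → moveTo s x y (x , s) ≡ (x , s ℤ.- + 1)
  moveTo-small s x y rewrite ≡ᵇ-refl x with s ℤP.≟ s
  ... | yes _  = refl
  ... | no s≢s = ⊥-elim (s≢s refl)

  moveTo-large : ∀ s {x y} → x < y → moveTo s x y (y , s) ≡ (y , s ℤ.+ + 1)
  moveTo-large s {x} {y} x<y rewrite ≢⇒≡ᵇ (<⇒≢ x<y ∘ sym) | ≡ᵇ-refl y with s ℤP.≟ s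
  ... | yes _  = refl
  ... | no s≢s = ⊥-elim (s≢s refl)

  moveTo-other : ∀ s x y {z t} → t ≢ s → moveTo s x y (z , t) ≡ (z , t)
  moveTo-other s x y {z} {t} t≢s with t ℤP.≟ s | z ≡ᵇ x | z ≡ᵇ y
  ... | yes t≡s | _     | _     = ⊥-elim (t≢s t≡s)
  ... | no _    | true  | true  = refl
  ... | no _    | true  | false = refl
  ... | no _    | false | true  = refl
  ... | no _    | false | false = refl

  -- Stability is asked only to the left of `s`: `step` takes the leftmost hot site, so further hot
  -- sites on the right do not interfere. Configurations are compared up to permutation because
  -- their order as lists carries no meaning.
  topple : ∀ {c d s x y} → c ↭ (x , s) ∷ (y , s) ∷ d → x < y →
           (∀ {z t} → (z , t) ∈ d → t ≢ s) →
           (∀ {z t} → (z , t) ∈ d → t ℤ.< s → Short (chipsAt t d)) →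
           ∃ λ c′ → step c ≡ just c′ × c′ ↭ (x , s ℤ.- + 1) ∷ (y , s ℤ.+ + 1) ∷ d
  topple {c} {d} {s} {x} {y} p x<y away short = map (moveTo s x y) c , eq _ refl s∈ (tabulate ≤hot) , moved
    where
    hot? : (t : ℤ) → Dec (2 ≤ length (chipsAt t c))
    hot? t = 2 ≤? length (chipsAt t c)
    at-s : chipsAt s c ↭ x ∷ y ∷ []
    at-s = ↭-trans (chipsAt-↭ s p) (↭-reflexive
      (≡.trans (chipsAt-∷-≡ s x _) (cong (x ∷_) (≡.trans (chipsAt-∷-≡ s y d)
        (cong (λ e → y ∷ map proj₁ e) (filter-none (at? s) (tabulate away)))))))
    s∈ : s ∈ hotSites c
    s∈ = ∈-filter⁺ hot? (∈-map⁺ proj₂ (∈-resp-↭ (↭-sym p) (here refl)))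
                   (≤-reflexive (sym (↭-length at-s)))
    ≤hot : ∀ {t} → t ∈ hotSites c → s ℤ.≤ t
    ≤hot {t} t∈ with s ℤP.≤? t
    ... | yes s≤t = s≤t
    ... | no  s≰t with ∈-filter⁻ hot? {xs = map proj₂ c} t∈
    ...   | t∈c , hot with ∈-map⁻ proj₂ t∈c
    ...     | _ , zt∈c , refl = ⊥-elim (<⇒≱ hot (≤-trans (≤-reflexive same) (short′ (∈-resp-↭ p zt∈c))))
      where
      t<s : t ℤ.< s
      t<s = ℤP.≰⇒> s≰t
      t≢ : s ≢ t
      t≢ refl = s≰t ℤP.≤-refl
      same : length (chipsAt t c) ≡ length (chipsAt t d)
      same = ≡.trans (↭-length (chipsAt-↭ t p))
        (cong length (≡.trans (chipsAt-∷-≢ x _ t≢) (chipsAt-∷-≢ y d t≢)))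
      short′ : ∀ {z} → (z , t) ∈ (x , s) ∷ (y , s) ∷ d → Short (chipsAt t d)
      short′ (here refl)         = ⊥-elim (t≢ refl)
      short′ (there (here refl)) = ⊥-elim (t≢ refl)
      short′ (there (there h))   = short h t<s
    eq : ∀ ts → hotSites c ≡ ts → s ∈ ts → All (s ℤ.≤_) ts → step c ≡ just (map (moveTo s x y) c)
    eq (h ∷ hs) h≡ s∈hs ≤hs =
      step-hot c h≡ (foldr-⊓-least s h hs s∈hs ≤hs) (minℕ-pair x<y at-s) (secondSmallest-pair x<y at-s)
    moved : map (moveTo s x y) c ↭ (x , s ℤ.- + 1) ∷ (y , s ℤ.+ + 1) ∷ d
    moved = ↭-trans (map⁺ (moveTo s x y) p) (↭-reflexive
      (cong₂ _∷_ (moveTo-small s x y) (cong₂ _∷_ (moveTo-large s x<y)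
        (map-id-local (tabulate (λ {zt} h → moveTo-other s x y (away {proj₁ zt} {proj₂ zt} h)))))))

  Unique-resp : ∀ {xs ys : List ℕ} → xs ↭ ys → Unique xs → Unique ys
  Unique-resp p = PermutationSetoid.Unique-resp-↭ (setoid ℕ) (↭⇒↭ₛ p)

  -- `step` recognises chips by their labels. Carrying distinctness along rules out a pair of equal
  -- labels on a site, for which no toppling would be defined.
  record _Shows_ (c : Config) (ls : Line) : Set where
    constructor shows
    field
      arranged : c ↭ place 0 ls
      distinct-labels : Unique (map proj₁ c)
  open _Shows_

  -- Quantifying over the fuel `f` that is left makes runs compose by adding their lengths, and lets
  -- a stable end absorb the excess fuel.
  record Reaches (k : ℕ) (c : Config) (ls : Line) : Set where
    constructor reaches
    field
      end      : Config
      run-to   : ∀ f → run (k + f) c ≡ run f end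
      end-line : end Shows ls

  reaches-in : ∀ {m n c ls} → m ≡ n → Reaches m c ls → Reaches n c ls
  reaches-in refl r = r

  run-step : ∀ {c d} f → step c ≡ just d → run (suc f) c ≡ run f d
  run-step {c} f eq with step c | eq
  ... | just _ | refl = refl

  reaches-⊕ : ∀ {k l c ls ms} → Reaches k c ls → (∀ {d} → d Shows ls → Reaches l d ms) → Reaches (k + l) c ms
  reaches-⊕ {k} {l} {c} (reaches d c→d d≈) next with next d≈
  ... | reaches e d→e e≈ =
    reaches e (λ f → ≡.trans (cong (λ j → run j c) (+-assoc k l f)) (≡.trans (c→d (l + f)) (d→e f))) e≈

  topple-ordered : ∀ {c L A x y B R} → All Short (A ∷ L) → x < y →
                   c Shows (L ʳ++ (A ∷ (x ∷ y ∷ []) ∷ B ∷ R)) →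
                   Reaches 1 c (L ʳ++ ((x ∷ A) ∷ [] ∷ (y ∷ B) ∷ R))
  topple-ordered {c} {L} {A} {x} {y} {B} {R} short x<y (shows c↭ uniq) =
    reaches _ (λ f → run-step f (proj₁ (proj₂ toppled))) (shows arranged′ uniq′)
    where
    ℓ = length L
    rest : Line
    rest = L ʳ++ (A ∷ [] ∷ B ∷ R)
    s : ℤ
    s = + suc ℓ
    start : c ↭ (x , s) ∷ (y , s) ∷ place 0 rest
    start = ↭-trans c↭ (↭-trans (place-insert (A ∷ L) x (y ∷ []) (B ∷ R))
                                (prep _ (place-insert (A ∷ L) y [] (B ∷ R))))
    away : ∀ {z t} → (z , t) ∈ place 0 rest → t ≢ s
    away h refl with subst (_ ∈_) (≡.trans (chipsAt-place 0 rest (suc ℓ))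
                      (≡.trans (cong (nth rest) (sym (+-identityʳ (suc ℓ)))) (nth-ʳ++ (A ∷ L) ([] ∷ B ∷ R) 0)))
                      (∈-chipsAt h)
    ... | ()
    below : ∀ {z t} → (z , t) ∈ place 0 rest → t ℤ.< s → Short (chipsAt t (place 0 rest))
    below h t<s with ∈-place⁻ 0 rest h
    ... | u , refl = subst Short (sym (chipsAt-place 0 rest u)) (nth-ʳ++-short short (ℤP.drop‿+<+ t<s))
    toppled = topple start x<y away below
    arranged′ : proj₁ toppled ↭ place 0 (L ʳ++ ((x ∷ A) ∷ [] ∷ (y ∷ B) ∷ R))
    arranged′ = ↭-trans (proj₂ (proj₂ toppled)) (↭-sym
      (↭-trans (place-insert L x A ([] ∷ (y ∷ B) ∷ R))
               (prep _ (↭-trans (place-insert ([] ∷ A ∷ L) y B R)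
                                (↭-reflexive (cong (λ u → (y , + suc u) ∷ place 0 rest) (+-comm 1 ℓ)))))))
    uniq′ : Unique (map proj₁ (proj₁ toppled))
    uniq′ = Unique-resp (↭-trans (map⁺ proj₁ start) (↭-sym (map⁺ proj₁ (proj₂ (proj₂ toppled))))) uniq

  shows-resp : ∀ {c ls ms} → place 0 ls ↭ place 0 ms → c Shows ls → c Shows ms
  shows-resp p (shows c↭ u) = shows (↭-trans c↭ p) u

  place-swap : ∀ L x y R → place 0 (L ʳ++ ((x ∷ y ∷ []) ∷ R)) ↭ place 0 (L ʳ++ ((y ∷ x ∷ []) ∷ R))
  place-swap L x y R = begin
    place 0 (L ʳ++ ((x ∷ y ∷ []) ∷ R))                       ↭⟨ place-insert L x _ R ⟩
    (x , + length L) ∷ place 0 (L ʳ++ ((y ∷ []) ∷ R))        ↭⟨ prep _ (place-insert L y _ R) ⟩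
    (x , + length L) ∷ (y , + length L) ∷ place 0 (L ʳ++ ([] ∷ R)) ↭⟨ swap _ _ refl ⟩
    (y , + length L) ∷ (x , + length L) ∷ place 0 (L ʳ++ ([] ∷ R)) ↭⟨ prep _ (place-insert L x _ R) ⟨
    (y , + length L) ∷ place 0 (L ʳ++ ((x ∷ []) ∷ R))        ↭⟨ place-insert L y _ R ⟨
    place 0 (L ʳ++ ((y ∷ x ∷ []) ∷ R))                       ∎
    where open PermutationReasoning

  topple-pair : ∀ {c L A x y B R} → All Short (A ∷ L) →
                c Shows (L ʳ++ (A ∷ (x ∷ y ∷ []) ∷ B ∷ R)) →
                Reaches 1 c (L ʳ++ ((x ⊓ y ∷ A) ∷ [] ∷ (x ⊔ y ∷ B) ∷ R))
  topple-pair {c} {L} {A} {x} {y} {B} {R} short sh with <-cmp x y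
  ... | tri< x<y _ _ rewrite m≤n⇒m⊓n≡m (<⇒≤ x<y) | m≤n⇒m⊔n≡n (<⇒≤ x<y) = topple-ordered short x<y sh
  ... | tri> _ _ y<x rewrite m≥n⇒m⊓n≡n (<⇒≤ y<x) | m≥n⇒m⊔n≡m (<⇒≤ y<x) =
    topple-ordered short y<x (shows-resp (place-swap (A ∷ L) x y (B ∷ R)) sh)
  ... | tri≈ _ refl _
    with Unique-resp (map⁺ proj₁ (↭-trans (arranged sh) (↭-trans (place-insert (A ∷ L) x _ _) (prep _ (place-insert (A ∷ L) x _ _))))) (distinct-labels sh)
  ... | (x≢x ∷ _) ∷ _ = ⊥-elim (x≢x refl)

  -- `cs` lists the window from right to left, beginning at the site where the next input arrives.
  -- The comparators are abstract because the same grid is read again with the roles of rows and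
  -- columns exchanged.
  module Network (lo hi : ℕ → ℕ → ℕ) where

    ins : ℕ → List ℕ → ℕ × List ℕ
    ins y []       = y , []
    ins y (c ∷ cs) = proj₁ (ins (lo y c) cs) , hi y c ∷ proj₂ (ins (lo y c) cs)

    outs cols : List ℕ → List ℕ → List ℕ
    outs []       cs = []
    outs (y ∷ ys) cs = proj₁ (ins y cs) ∷ outs ys (proj₂ (ins y cs))
    cols []       cs = cs
    cols (y ∷ ys) cs = cols ys (proj₂ (ins y cs))

  open Network _⊓_ _⊔_

  singles : List ℕ → Line
  singles = map [_]

  singles-short : ∀ xs → All Short (singles xs)
  singles-short xs = All.map⁺ (universal (λ _ → s≤s z≤n) xs)

  -- The smaller chip of the pair lands on the next window site and makes it the leftmost hot one,
  -- so the descent continues until a chip reaches the hole; the site holding `B` may be hot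
  -- meanwhile, but it lies further right. Every larger chip moves one site to the right. Altogether
  -- the window and the hole shift right by one, and the output rests where the hole was.
  pass : ∀ {k} y c₁ cs O B R → All Short O →
         k Shows ((singles cs ++ [] ∷ O) ʳ++ ((y ∷ c₁ ∷ []) ∷ B ∷ R)) →
         Reaches (suc (length cs)) k
           (O ʳ++ ([ proj₁ (ins y (c₁ ∷ cs)) ] ∷ [] ∷ (singles (proj₂ (ins (y ⊓ c₁) cs)) ʳ++ ((y ⊔ c₁ ∷ B) ∷ R))))
  pass y c₁ []       O B R short sh = topple-pair (z≤n ∷ short) sh
  pass y c₁ (c ∷ cs) O B R short sh =
    reaches-⊕ (topple-pair (All.++⁺ (singles-short (c ∷ cs)) (z≤n ∷ short)) sh)
              (pass (y ⊓ c₁) c cs O [] ((y ⊔ c₁ ∷ B) ∷ R) short)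

  length-ins : ∀ y cs → length (proj₂ (ins y cs)) ≡ length cs
  length-ins y []       = refl
  length-ins y (c ∷ cs) = cong suc (length-ins (y ⊓ c) cs)

  -- `os` holds the outputs so far, latest first. The inner empty site is the hole between outputs
  -- and window (site 0 at the start), the last one is site n + 1.
  before : List ℕ → ℕ → ℕ → List ℕ → List ℕ → Line
  before os y c cs ys = (singles cs ++ [] ∷ singles os) ʳ++ ((y ∷ c ∷ []) ∷ singles ys ++ [ [] ])

  rounds : ∀ {k} os y ys c cs → k Shows before os y c cs ys →
           Reaches (suc (length ys) * suc (length cs)) k
             ((singles (cols (y ∷ ys) (c ∷ cs)) ++ [] ∷ singles (outs (y ∷ ys) (c ∷ cs) ʳ++ os)) ʳ++ [])
  rounds {k} os y [] c cs sh =
    reaches-in (sym (+-identityʳ (suc (length cs))))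
      (subst (Reaches (suc (length cs)) k) (sym (shape [])) (pass y c cs (singles os) [] [] (singles-short os) sh))
    where
    shape : ∀ R → (singles (y ⊔ c ∷ proj₂ (ins (y ⊓ c) cs)) ++ [] ∷ [ proj₁ (ins y (c ∷ cs)) ] ∷ singles os) ʳ++ R
          ≡ singles os ʳ++ ([ proj₁ (ins y (c ∷ cs)) ] ∷ [] ∷ (singles (proj₂ (ins (y ⊓ c) cs)) ʳ++ ([ y ⊔ c ] ∷ R)))
    shape R = ++-ʳ++ (singles (y ⊔ c ∷ proj₂ (ins (y ⊓ c) cs)))
  rounds {k} os y (y′ ∷ ys) c cs sh =
    reaches-⊕ (pass y c cs (singles os) [ y′ ] (singles ys ++ [ [] ]) (singles-short os) sh)
      (λ sh′ → reaches-in (cong (λ n → suc (length ys) * suc n) (length-ins (y ⊓ c) cs))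
        (rounds (o ∷ os) y′ ys (y ⊔ c) cs′
          -- `pass` puts `y ⊔ c` in front of the chip `y′` already on its new site, whereas `before`
          -- lists the incoming chip first.
          (shows-resp (↭-trans (↭-reflexive (cong (place 0) (sym shape))) (place-swap (singles cs′ ++ [] ∷ singles (o ∷ os)) (y ⊔ c) y′ _)) sh′)))
    where
    o = proj₁ (ins y (c ∷ cs))
    cs′ = proj₂ (ins (y ⊓ c) cs)
    shape : ∀ {R} → (singles cs′ ++ [] ∷ singles (o ∷ os)) ʳ++ R ≡ singles os ʳ++ ([ o ] ∷ [] ∷ (singles cs′ ʳ++ R))
    shape = ++-ʳ++ (singles cs′)

  short-↭ : ∀ {xs ys : List ℕ} → Short ys → xs ↭ ys → xs ≡ ys
  short-↭ {ys = []}     _ p = ↭-empty-inv p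
  short-↭ {ys = y ∷ []} _ p = ↭-singleton-inv p
  short-↭ {ys = _ ∷ _ ∷ _} (s≤s ()) p

  nth-short : ∀ {ls} → All Short ls → ∀ u → Short (nth ls u)
  nth-short []       u       = z≤n
  nth-short (s ∷ ss) zero    = s
  nth-short (s ∷ ss) (suc u) = nth-short ss u

  chipsAt-shown : ∀ {c ls} → c Shows ls → ∀ u → chipsAt (+ u) c ↭ nth ls u
  chipsAt-shown {ls = ls} sh u = ↭-trans (chipsAt-↭ (+ u) (arranged sh)) (↭-reflexive (chipsAt-place 0 ls u))

  short⇒no-hotSites : ∀ {c ls} → c Shows ls → All Short ls → hotSites c ≡ []
  short⇒no-hotSites {c} {ls} sh short = filter-none (λ s → 2 ≤? length (chipsAt s c)) (tabulate cold)
    where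
    cold : ∀ {t} → t ∈ map proj₂ c → ¬ 2 ≤ length (chipsAt t c)
    cold t∈ hot with ∈-map⁻ proj₂ t∈
    ... | (z , t) , zt∈ , refl with ∈-place⁻ 0 ls (∈-resp-↭ (arranged sh) zt∈)
    ...   | u , refl = <⇒≱ hot (≤-trans (≤-reflexive (↭-length (chipsAt-shown sh u))) (nth-short short u))

  map-nth : ∀ ls → applyUpTo (nth ls) (length ls) ≡ ls
  map-nth []        = refl
  map-nth (xs ∷ ls) = cong (xs ∷_) (map-nth ls)

  reading-short : ∀ {c ls} n → c Shows ls → All Short ls → length ls ≡ suc (suc n) → reading n c ≡ concat ls
  reading-short {c} {ls} n sh short len = cong concat (begin
    map (λ s → chipsAt (+ s) c) (upTo (suc (suc n)))  ≡⟨ map-cong (λ u → short-↭ (nth-short short u) (chipsAt-shown sh u)) (upTo (suc (suc n))) ⟩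
    map (nth ls) (upTo (suc (suc n)))                 ≡⟨ map-applyUpTo (λ u → u) (nth ls) (suc (suc n)) ⟩
    applyUpTo (nth ls) (suc (suc n))                  ≡⟨ cong (applyUpTo (nth ls)) len ⟨
    applyUpTo (nth ls) (length ls)                    ≡⟨ map-nth ls ⟩
    ls                                                ∎)
    where open ≡-Reasoning

  concat-singles-ʳ++ : ∀ xs R → concat (singles xs ʳ++ R) ≡ xs ʳ++ concat R
  concat-singles-ʳ++ []       R = refl
  concat-singles-ʳ++ (x ∷ xs) R = concat-singles-ʳ++ xs ([ x ] ∷ R)

  after : List ℕ → List ℕ → Line
  after os cs = (singles cs ++ [] ∷ singles (os ʳ++ [])) ʳ++ []

  concat-after : ∀ os cs → concat (after os cs) ≡ os ++ reverse cs
  concat-after os cs = begin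
    concat (after os cs)                                             ≡⟨ cong concat (++-ʳ++ (singles cs)) ⟩
    concat (singles (os ʳ++ []) ʳ++ ([] ∷ (singles cs ʳ++ [])))      ≡⟨ concat-singles-ʳ++ (os ʳ++ []) _ ⟩
    (os ʳ++ []) ʳ++ concat (singles cs ʳ++ [])                       ≡⟨ ʳ++-ʳ++ os ⟩
    os ++ concat (singles cs ʳ++ [])                                 ≡⟨ cong (os ++_) (concat-singles-ʳ++ cs []) ⟩
    os ++ (cs ʳ++ [])                                                ∎
    where open ≡-Reasoning

  length-after : ∀ os cs → length (after os cs) ≡ suc (length cs + length os)
  length-after os cs = begin
    length (after os cs)                                            ≡⟨ length-ʳ++ (singles cs ++ [] ∷ singles (os ʳ++ [])) ⟩
    length (singles cs ++ [] ∷ singles (os ʳ++ [])) + 0             ≡⟨ +-identityʳ _ ⟩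
    length (singles cs ++ [] ∷ singles (os ʳ++ []))                 ≡⟨ length-++ (singles cs) ⟩
    length (singles cs) + suc (length (singles (os ʳ++ [])))        ≡⟨ cong₂ (λ a b → a + suc b) (length-map [_] cs) (≡.trans (length-map [_] (os ʳ++ [])) (≡.trans (length-ʳ++ os) (+-identityʳ (length os)))) ⟩
    length cs + suc (length os)                                     ≡⟨ +-suc (length cs) (length os) ⟩
    suc (length cs + length os)                                     ∎
    where open ≡-Reasoning

  after-short : ∀ os cs → All Short (after os cs)
  after-short os cs = All-ʳ++ (All.++⁺ (singles-short cs) (z≤n ∷ singles-short (os ʳ++ []))) []
    where
    All-ʳ++ : ∀ {L R} → All Short L → All Short R → All Short (L ʳ++ R)
    All-ʳ++ []       rs = rs
    All-ʳ++ (l ∷ ls) rs = All-ʳ++ ls (l ∷ rs)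

  length-outs : ∀ ys cs → length (outs ys cs) ≡ length ys
  length-outs []       cs = refl
  length-outs (y ∷ ys) cs = cong suc (length-outs ys _)

  length-cols : ∀ ys cs → length (cols ys cs) ≡ length cs
  length-cols []       cs = refl
  length-cols (y ∷ ys) cs = ≡.trans (length-cols ys _) (length-ins y cs)

  run-stable : ∀ f {c} → hotSites c ≡ [] → run f c ≡ c
  run-stable zero    eq = refl
  run-stable (suc f) {c} eq with step c | step-stable c eq
  ... | _ | refl = refl

  label : ℕ → ℕ → ℕ
  label r v = if v <ᵇ r then v else suc v

  zip-place : ∀ {A : Set} (g : A → ℕ) (f : ℕ → ℕ) i → (∀ j → f j ≡ i + j) → ∀ xs →
              map (λ iv → (g (proj₂ iv) , + proj₁ iv)) (zip (applyUpTo f (length xs)) xs)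
                ≡ place i (singles (map g xs) ++ [ [] ])
  zip-place g f i f≗ []       = refl
  zip-place g f i f≗ (x ∷ xs) = cong₂ _∷_ (cong (λ j → (g x , + j)) (≡.trans (f≗ 0) (+-identityʳ i)))
    (zip-place g (f ∘ suc) (suc i) (λ j → ≡.trans (f≗ (suc j)) (+-suc i j)) xs)

  chips : ∀ {n} → ℕ → Vec (Fin n) n → List ℕ
  chips r π = map (λ v → label r (suc (toℕ v))) (toList π)

  initConfig-place : ∀ {n} r p (π : Vec (Fin n) n) →
                     initConfig r p π ≡ (r , + p) ∷ place 0 ([] ∷ singles (chips r π) ++ [ [] ])
  initConfig-place {n} r p π = cong ((r , + p) ∷_) (≡.trans
    (cong (λ js → map (λ iv → (label r (suc (toℕ (proj₂ iv))) , + proj₁ iv)) (zip js (toList π)))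
      (≡.trans (map-applyUpTo (λ u → u) suc n) (cong (applyUpTo suc) (sym (length-toList π)))))
    (zip-place (λ v → label r (suc (toℕ v))) suc 1 (λ _ → refl) (toList π)))

  module _ {n : ℕ} (r : ℕ) (π : Vec (Fin n) n) (cs : List ℕ) (c : ℕ) (ys : List ℕ)
           (split : chips r π ≡ cs ʳ++ (c ∷ ys)) (uniq : Unique (r ∷ chips r π)) where

    private
      p = suc (length cs)
      k = suc (length ys) * suc (length cs)
      os = outs (r ∷ ys) (c ∷ cs)
      ds = cols (r ∷ ys) (c ∷ cs)

    length-window : length cs + suc (length ys) ≡ n
    length-window = begin
      length cs + suc (length ys)     ≡⟨ length-ʳ++ cs ⟨
      length (cs ʳ++ (c ∷ ys))        ≡⟨ cong length split ⟨
      length (chips r π)              ≡⟨ length-map _ (toList π) ⟩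
      length (toList π)               ≡⟨ length-toList π ⟩
      n                               ∎
      where open ≡-Reasoning

    initConfig-shows : initConfig r p π Shows before [] r c cs ys
    initConfig-shows = shows (↭-trans (↭-reflexive (initConfig-place r p π)) (↭-sym arrange))
      (subst Unique (cong (r ∷_) labels) uniq)
      where
      line : (singles cs ++ [ [] ]) ʳ++ ([ c ] ∷ singles ys ++ [ [] ]) ≡ [] ∷ singles (chips r π) ++ [ [] ]
      line = begin
        (singles cs ++ [ [] ]) ʳ++ ([ c ] ∷ singles ys ++ [ [] ])  ≡⟨ ++-ʳ++ (singles cs) ⟩
        [] ∷ (singles cs ʳ++ (singles (c ∷ ys) ++ [ [] ]))         ≡⟨ cong ([] ∷_) (ʳ++-++ (singles cs) _ _) ⟩
        [] ∷ (singles cs ʳ++ singles (c ∷ ys)) ++ [ [] ]           ≡⟨ cong (λ l → [] ∷ l ++ [ [] ]) (sym (map-ʳ++ [_] cs)) ⟩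
        [] ∷ singles (cs ʳ++ (c ∷ ys)) ++ [ [] ]                   ≡⟨ cong (λ l → [] ∷ singles l ++ [ [] ]) split ⟨
        [] ∷ singles (chips r π) ++ [ [] ]                         ∎
        where
        open ≡-Reasoning
        ʳ++-++ : ∀ (A B C : Line) → A ʳ++ (B ++ C) ≡ (A ʳ++ B) ++ C
        ʳ++-++ []      B C = refl
        ʳ++-++ (x ∷ A) B C = ʳ++-++ A (x ∷ B) C
      len : length (singles cs ++ [ [] ]) ≡ p
      len = ≡.trans (length-++ (singles cs)) (≡.trans (+-comm _ 1) (cong suc (length-map [_] cs)))
      arrange : place 0 (before [] r c cs ys) ↭ (r , + p) ∷ place 0 ([] ∷ singles (chips r π) ++ [ [] ])
      arrange = ↭-trans (place-insert (singles cs ++ [ [] ]) r [ c ] (singles ys ++ [ [] ]))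
        (↭-reflexive (cong₂ (λ l L → (r , + l) ∷ place 0 L) len line))
      labels : chips r π ≡ map proj₁ (map _ (zip (map suc (upTo n)) (toList π)))
      labels = sym (≡.trans (cong (λ d → drop 1 (map proj₁ d)) (initConfig-place r p π)) (labels-place 1 (chips r π)))
        where
        labels-place : ∀ i xs → map proj₁ (place i (singles xs ++ [ [] ])) ≡ xs
        labels-place i []       = refl
        labels-place i (x ∷ xs) = cong (x ∷_) (labels-place (suc i) xs)

    -- The run makes one toppling per comparator of the grid, (n - p + 1) p in all, and both factors
    -- are at most n + 2.
    steps≤fuel : k ≤ fuel n
    steps≤fuel = ≤-trans (*-mono-≤ (≤-trans (m≤n+m _ (length cs)) (≤-trans (≤-reflexive length-window) (m≤n+m n 2)))
                                   (≤-trans (s≤s (m≤m+n (length cs) (suc (length ys)))) (≤-trans (s≤s (≤-reflexive length-window)) (n≤1+n _))))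
                         (m≤m*n (suc (suc n) * suc (suc n)) (suc (suc n)))

    toppleable-outs : toppleable r p π ≡ ⌊ ≡-dec _≟_ (os ++ reverse ds) (idList n) ⌋
    toppleable-outs with rounds [] r ys c cs initConfig-shows
    ... | reaches d run-to d≈ = begin
      toppleable r p π                                          ≡⟨ cong (λ e → isStable e ∧ ⌊ ≡-dec _≟_ (reading n e) (idList n) ⌋) final ⟩
      isStable d ∧ ⌊ ≡-dec _≟_ (reading n d) (idList n) ⌋       ≡⟨ cong (_∧ ⌊ ≡-dec _≟_ (reading n d) (idList n) ⌋) (isStable-stable d cold) ⟩
      ⌊ ≡-dec _≟_ (reading n d) (idList n) ⌋                    ≡⟨ cong (λ l → ⌊ ≡-dec _≟_ l (idList n) ⌋) (≡.trans (reading-short n d≈ short len) (concat-after os ds)) ⟩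
      ⌊ ≡-dec _≟_ (os ++ reverse ds) (idList n) ⌋               ∎
      where
      open ≡-Reasoning
      short : All Short (after os ds)
      short = after-short os ds
      cold : hotSites d ≡ []
      cold = short⇒no-hotSites d≈ short
      final : finalConfig r p π ≡ d
      final = ≡.trans (cong (λ f → run f (initConfig r p π)) (sym (m+[n∸m]≡n steps≤fuel)))
        (≡.trans (run-to (fuel n ∸ k)) (run-stable (fuel n ∸ k) cold))
      len : length (after os ds) ≡ suc (suc n)
      len = ≡.trans (length-after os ds) (cong suc (≡.trans (cong₂ _+_ (length-cols (r ∷ ys) (c ∷ cs)) (length-outs (r ∷ ys) (c ∷ cs)))
        (cong suc length-window)))

open ChipFiring

-- Selection by a grid of comparators, read by rows and by columns.

module Sorting where
  open import Data.Nat using (_+_; _*_)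
  open ℕP

  -- The order is abstract because it is used in both directions: ascending for the inputs,
  -- descending for the window chips.
  module Selection
    (_⊑_ : ℕ → ℕ → Set) (lo hi : ℕ → ℕ → ℕ)
    (⊑-refl : ∀ {x} → x ⊑ x) (⊑-trans : ∀ {x y z} → x ⊑ y → y ⊑ z → x ⊑ z)
    (⊑-antisym : ∀ {x y} → x ⊑ y → y ⊑ x → x ≡ y)
    (compare : ∀ x y → (x ⊑ y × lo x y ≡ x × hi x y ≡ y) ⊎ (y ⊑ x × lo x y ≡ y × hi x y ≡ x))
    where
    open Network lo hi

    _⊏_ : ℕ → ℕ → Set
    x ⊏ y = x ⊑ y × x ≢ y

    ins-↭ : ∀ y cs → proj₁ (ins y cs) ∷ proj₂ (ins y cs) ↭ y ∷ cs
    ins-↭ y []       = refl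
    ins-↭ y (c ∷ cs) = ↭-trans (swap _ _ refl) (↭-trans (prep _ (ins-↭ (lo y c) cs)) pair)
      where
      pair : hi y c ∷ lo y c ∷ cs ↭ y ∷ c ∷ cs
      pair with compare y c
      ... | inj₁ (_ , lo≡ , hi≡) rewrite lo≡ | hi≡ = swap c y refl
      ... | inj₂ (_ , lo≡ , hi≡) rewrite lo≡ | hi≡ = refl

    ins-least : ∀ y cs → All (proj₁ (ins y cs) ⊑_) (y ∷ cs)
    ins-least y []       = ⊑-refl ∷ []
    ins-least y (c ∷ cs) with ins-least (lo y c) cs | compare y c
    ... | o⊑lo ∷ o⊑cs | inj₁ (y⊑c , lo≡ , _) =
      let o⊑y = subst (proj₁ (ins (lo y c) cs) ⊑_) lo≡ o⊑lo in o⊑y ∷ ⊑-trans o⊑y y⊑c ∷ o⊑cs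
    ... | o⊑lo ∷ o⊑cs | inj₂ (c⊑y , lo≡ , _) =
      let o⊑c = subst (proj₁ (ins (lo y c) cs) ⊑_) lo≡ o⊑lo in ⊑-trans o⊑c c⊑y ∷ o⊑c ∷ o⊑cs

    private
      later : ∀ {y ys a L} cs → proj₁ (ins y cs) ≡ a → cs ++ y ∷ ys ↭ a ∷ L → proj₂ (ins y cs) ++ ys ↭ L
      later {y} {ys} cs refl p = drop-∷ (↭-trans (++⁺ʳ ys (ins-↭ y cs)) (↭-trans (↭-sym (shift y cs ys)) p))

      least : ∀ {a L x} → All (a ⊏_) L → x ∈ a ∷ L → a ⊑ x
      least a⊏L (here refl) = ⊑-refl
      least a⊏L (there x∈L) = proj₁ (lookup a⊏L x∈L)

    -- As long as the outputs are the initial terms of the sorted list, the chips still present are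
    -- exactly its remaining terms. The next input is one of these, hence not below their least term
    -- `a`.
    outs⇒⊑ : ∀ {L₂} L₁ ys cs → AllPairs _⊏_ (L₁ ++ L₂) → cs ++ ys ↭ L₁ ++ L₂ →
             outs ys cs ≡ L₁ → Pointwise _⊑_ L₁ ys
    outs⇒⊑ []       []       cs sorted      p eq   = []
    outs⇒⊑ (a ∷ L₁) (y ∷ ys) cs (a⊏ ∷ sorted) p eq with ∷-injective eq
    ... | o≡a , os≡ =
      least a⊏ (∈-resp-↭ p (∈-++⁺ʳ cs (here refl))) ∷ outs⇒⊑ L₁ ys _ sorted (later cs o≡a p) os≡

    -- Each later input dominates a term strictly above `a`, so `a` is not among the later inputs.
    -- It is therefore in the window or is the current input, and `ins` expels it, being the least
    -- chip present.
    ⊑⇒outs : ∀ {L₂} L₁ ys cs → AllPairs _⊏_ (L₁ ++ L₂) → cs ++ ys ↭ L₁ ++ L₂ →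
             Pointwise _⊑_ L₁ ys → outs ys cs ≡ L₁
    ⊑⇒outs []       []       cs sorted        p []          = refl
    ⊑⇒outs {L₂} (a ∷ L₁) (y ∷ ys) cs (a⊏ ∷ sorted) p (a⊑y ∷ L₁⊑) =
      cong₂ _∷_ o≡a (⊑⇒outs L₁ ys _ sorted (later cs o≡a p) L₁⊑)
      where
      above : ∀ {L x} zs → Pointwise _⊑_ L zs → All (a ⊏_) L → x ∈ zs → a ⊏ x
      above (z ∷ zs) (l⊑z ∷ _) ((a⊑l , a≢l) ∷ _) (here refl) =
        ⊑-trans a⊑l l⊑z , λ { refl → a≢l (⊑-antisym a⊑l l⊑z) }
      above (z ∷ zs) (_ ∷ L⊑) (_ ∷ a⊏L) (there h) = above zs L⊑ a⊏L h
      prefix : ∀ {L M} → All (a ⊏_) (L ++ M) → All (a ⊏_) L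
      prefix {[]}    h       = []
      prefix {_ ∷ _} (h ∷ t) = h ∷ prefix t
      a∈ : a ∈ y ∷ cs
      a∈ with ∈-++⁻ (y ∷ cs) (∈-resp-↭ (↭-trans (↭-sym p) (shift y cs ys)) (here refl))
      ... | inj₁ h = h
      ... | inj₂ h = ⊥-elim (proj₂ (above ys L₁⊑ (prefix a⊏) h) refl)
      o∈ : proj₁ (ins y cs) ∈ a ∷ L₁ ++ L₂
      o∈ = ∈-resp-↭ (↭-trans (++⁺ʳ ys (ins-↭ y cs)) (↭-trans (↭-sym (shift y cs ys)) p)) (here refl)
      o≡a : proj₁ (ins y cs) ≡ a
      o≡a = ⊑-antisym (lookup (ins-least y cs) a∈) (least a⊏ o∈)

  -- The grid of comparators may be evaluated column by column instead of row by row.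
  module Transposition (lo hi : ℕ → ℕ → ℕ) where
    open Network lo hi
    module Columns = Network (flip hi) (flip lo)

    -- The first window place keeps the larger chip of every comparison and hands the smaller one
    -- on. Followed in time, its chip runs through `ys` as an input of the column network, and what
    -- it hands on are the inputs seen by the remaining places.
    cols-∷ : ∀ ys c cs → cols ys (c ∷ cs) ≡ proj₁ (Columns.ins c ys) ∷ cols (proj₂ (Columns.ins c ys)) cs
    cols-∷ []       c cs = refl
    cols-∷ (y ∷ ys) c cs = cols-∷ ys (hi y c) (proj₂ (ins (lo y c) cs))

    cols≡outs : ∀ ys cs → cols ys cs ≡ Columns.outs cs ys
    cols≡outs ys []       = cols-[] ys
      where
      cols-[] : ∀ ys → cols ys [] ≡ []
      cols-[] []       = refl
      cols-[] (y ∷ ys) = cols-[] ys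
    cols≡outs ys (c ∷ cs) = ≡.trans (cols-∷ ys c cs) (cong (proj₁ (Columns.ins c ys) ∷_) (cols≡outs (proj₂ (Columns.ins c ys)) cs))

  ≤-compare : ∀ x y → (x ≤ y × x ⊓ y ≡ x × x ⊔ y ≡ y) ⊎ (y ≤ x × x ⊓ y ≡ y × x ⊔ y ≡ x)
  ≤-compare x y with ≤-total x y
  ... | inj₁ x≤y = inj₁ (x≤y , m≤n⇒m⊓n≡m x≤y , m≤n⇒m⊔n≡n x≤y)
  ... | inj₂ y≤x = inj₂ (y≤x , m≥n⇒m⊓n≡n y≤x , m≥n⇒m⊔n≡m y≤x)

  ≥-compare : ∀ x y → (x ≥ y × y ⊔ x ≡ x × y ⊓ x ≡ y) ⊎ (y ≥ x × y ⊔ x ≡ y × y ⊓ x ≡ x)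
  ≥-compare x y with ≤-total x y
  ... | inj₁ x≤y = inj₂ (x≤y , m≥n⇒m⊔n≡m x≤y , m≥n⇒m⊓n≡n x≤y)
  ... | inj₂ y≤x = inj₁ (y≤x , m≤n⇒m⊔n≡n y≤x , m≤n⇒m⊓n≡m y≤x)

  module Ascending = Selection _≤_ _⊓_ _⊔_ ≤-refl ≤-trans ≤-antisym ≤-compare

  -- The flips make this instance agree literally with the column network obtained from
  -- `Transposition _⊓_ _⊔_`, so `cols≡outs` applies without conversion.
  module Descending = Selection _≥_ (flip _⊔_) (flip _⊓_) ≤-refl (flip ≤-trans) (flip ≤-antisym) ≥-compare

  open Network _⊓_ _⊔_
  open Transposition _⊓_ _⊔_ using (cols≡outs)

  applyUpTo-+ : ∀ {A : Set} (f : ℕ → A) a b → applyUpTo f (a + b) ≡ applyUpTo f a ++ applyUpTo (λ i → f (a + i)) b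
  applyUpTo-+ f zero    b = refl
  applyUpTo-+ f (suc a) b = cong (f 0 ∷_) (applyUpTo-+ (f ∘ suc) a b)

  applyDownFrom-+ : ∀ {A : Set} (f : ℕ → A) a b → applyDownFrom f (b + a) ≡ applyDownFrom (λ i → f (i + a)) b ++ applyDownFrom f a
  applyDownFrom-+ f a zero    = refl
  applyDownFrom-+ f a (suc b) = cong (f (b + a) ∷_) (applyDownFrom-+ f a b)

  ++-injective : ∀ {A : Set} (ws xs : List A) {ys zs} → length ws ≡ length xs → ws ++ ys ≡ xs ++ zs → ws ≡ xs × ys ≡ zs
  ++-injective []       []       len eq = refl , eq
  ++-injective (w ∷ ws) (x ∷ xs) len eq with ∷-injective eq
  ... | refl , eq′ with ++-injective ws xs (suc-injective len) eq′
  ...   | refl , eq″ = refl , eq″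

  module Sorted (ys cs : List ℕ) (p q : ℕ) (len-ys : length ys ≡ q) (len-cs : length cs ≡ p)
                (all : cs ++ ys ↭ applyUpTo suc (q + p)) where

    -- The labels q + p, ..., q + 1, descending because the final window is listed from right to
    -- left.
    large : List ℕ
    large = applyDownFrom (λ i → suc (i + q)) p

    private
      asc : applyUpTo suc (q + p) ≡ applyUpTo suc q ++ applyUpTo (λ i → suc (q + i)) p
      asc = applyUpTo-+ suc q p

      desc : applyDownFrom suc (p + q) ≡ large ++ applyDownFrom suc q
      desc = applyDownFrom-+ suc q p

      target : applyUpTo suc (q + p) ≡ applyUpTo suc q ++ reverse large
      target = begin
        applyUpTo suc (q + p)                                  ≡⟨ asc ⟩
        applyUpTo suc q ++ applyUpTo (λ i → suc (q + i)) p     ≡⟨ cong (applyUpTo suc q ++_) (applyUpTo-cong p) ⟩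
        applyUpTo suc q ++ applyUpTo (λ i → suc (i + q)) p     ≡⟨ cong (applyUpTo suc q ++_) (reverse-applyDownFrom (λ i → suc (i + q)) p) ⟨
        applyUpTo suc q ++ reverse large                       ∎
        where
        open ≡-Reasoning
        applyUpTo-cong : ∀ k → applyUpTo (λ i → suc (q + i)) k ≡ applyUpTo (λ i → suc (i + q)) k
        applyUpTo-cong k = ≡.trans (sym (map-upTo _ k)) (≡.trans (map-cong (λ i → cong suc (+-comm q i)) (upTo k)) (map-upTo _ k))

      ↭-asc : cs ++ ys ↭ applyUpTo suc q ++ applyUpTo (λ i → suc (q + i)) p
      ↭-asc = ↭-trans all (↭-reflexive asc)

      ↭-desc : ys ++ cs ↭ large ++ applyDownFrom suc q
      ↭-desc = begin
        ys ++ cs                          ↭⟨ ++-comm ys cs ⟩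
        cs ++ ys                          ↭⟨ all ⟩
        applyUpTo suc (q + p)             ≡⟨ cong (applyUpTo suc) (+-comm q p) ⟩
        applyUpTo suc (p + q)             ≡⟨ reverse-applyDownFrom suc (p + q) ⟨
        reverse (applyDownFrom suc (p + q)) ↭⟨ ↭-reverse _ ⟩
        applyDownFrom suc (p + q)         ≡⟨ desc ⟩
        large ++ applyDownFrom suc q      ∎
        where open PermutationReasoning

      asc-sorted : AllPairs Ascending._⊏_ (applyUpTo suc q ++ applyUpTo (λ i → suc (q + i)) p)
      asc-sorted = subst (AllPairs Ascending._⊏_) asc
        (applyUpTo⁺₁ suc (q + p) (λ i<j _ → s≤s (<⇒≤ i<j) , <⇒≢ (s≤s i<j)))

      desc-sorted : AllPairs Descending._⊏_ (large ++ applyDownFrom suc q)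
      desc-sorted = subst (AllPairs Descending._⊏_) desc
        (applyDownFrom⁺₁ suc (p + q) (λ j<i _ → s≤s (<⇒≤ j<i) , (λ eq → <⇒≢ (s≤s j<i) (sym eq))))

      parts : outs ys cs ++ reverse (cols ys cs) ≡ applyUpTo suc (q + p) → outs ys cs ≡ applyUpTo suc q × cols ys cs ≡ large
      parts eq with ++-injective _ _ (≡.trans (length-outs ys cs) (≡.trans len-ys (sym (length-applyUpTo suc q)))) (≡.trans eq target)
      ... | os≡ , rev≡ = os≡ , reverse-injective rev≡

    sorted⇒bounded : outs ys cs ++ reverse (cols ys cs) ≡ applyUpTo suc (q + p) →
                     Pointwise _≤_ (applyUpTo suc q) ys × Pointwise _≥_ large cs
    sorted⇒bounded eq =
      Ascending.outs⇒⊑ _ ys cs asc-sorted ↭-asc (proj₁ (parts eq)) ,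
      Descending.outs⇒⊑ _ cs ys desc-sorted ↭-desc (≡.trans (sym (cols≡outs ys cs)) (proj₂ (parts eq)))

    bounded⇒sorted : Pointwise _≤_ (applyUpTo suc q) ys → Pointwise _≥_ large cs →
                     outs ys cs ++ reverse (cols ys cs) ≡ applyUpTo suc (q + p)
    bounded⇒sorted ys-large cs-small = ≡.trans (cong₂ (λ a b → a ++ reverse b)
      (Ascending.⊑⇒outs _ ys cs asc-sorted ↭-asc ys-large)
      (≡.trans (cols≡outs ys cs) (Descending.⊑⇒outs _ cs ys desc-sorted ↭-desc cs-small))) (sym target)

open Sorting

-- From sorted outputs to a bound on each letter.

module Criterion where
  open import Data.Nat using (_+_)
  open ℕP

  member : ℕ → List ℕ → Bool
  member x = any (x ≡ᵇ_)

  member-true : ∀ {x} xs → member x xs ≡ true ⇔ x ∈ xs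
  member-true {x} xs = mk⇔ (⇒ xs) (⇐ xs)
    where
    ⇒ : ∀ xs → member x xs ≡ true → x ∈ xs
    ⇒ (y ∷ ys) h with x ≡ᵇ y in eq
    ... | true  = here (to ≡ᵇ-true eq)
    ... | false = there (⇒ ys h)
    ⇐ : ∀ xs → x ∈ xs → member x xs ≡ true
    ⇐ (y ∷ ys) (here refl) rewrite ≡ᵇ-refl x = refl
    ⇐ (y ∷ ys) (there h) with x ≡ᵇ y
    ... | true  = refl
    ... | false = ⇐ ys h

  distinct-true : ∀ xs → distinct xs ≡ true ⇔ Unique xs
  distinct-true []       = mk⇔ (λ _ → []) (λ _ → refl)
  distinct-true (x ∷ xs) = mk⇔ ⇒ ⇐
    where
    ⇒ : distinct (x ∷ xs) ≡ true → Unique (x ∷ xs)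
    ⇒ h with ∧-true {not (member x xs)} h
    ... | x∉ , xs-distinct = tabulate (λ { y∈ refl → absurd (from (member-true xs) y∈) x∉ }) ∷ to (distinct-true xs) xs-distinct
      where
      absurd : ∀ {b} {A : Set} → b ≡ true → not b ≡ true → A
      absurd refl ()
    ⇐ : Unique (x ∷ xs) → distinct (x ∷ xs) ≡ true
    ⇐ (x∉ ∷ u) rewrite ≢-true⇒false (λ h → lookup x∉ (to (member-true xs) h) refl) = from (distinct-true xs) u

  -- Delete the head of `xs` from `ys`: the inclusion of the tail survives because the head does not
  -- recur in it, and both lengths drop by one.
  pigeonhole : ∀ {xs ys : List ℕ} → Unique xs → (∀ {x} → x ∈ xs → x ∈ ys) → length ys ≤ length xs → xs ↭ ys
  pigeonhole {[]} {[]} _ _ _ = refl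
  pigeonhole {x ∷ xs} (x∉ ∷ u) sub len with ∈-∃++ (sub (here refl))
  ... | as , bs , refl = ↭-trans (prep x (pigeonhole u sub′ len′)) (↭-sym (shift x as bs))
    where
    sub′ : ∀ {z} → z ∈ xs → z ∈ as ++ bs
    sub′ z∈ with ∈-resp-↭ (shift x as bs) (sub (there z∈))
    ... | here refl = ⊥-elim (lookup x∉ z∈ refl)
    ... | there h   = h
    len′ : length (as ++ bs) ≤ length xs
    len′ = s≤s⁻¹ (≤-trans (≤-reflexive (sym (↭-length (shift x as bs)))) len)

  Row : Set
  Row = ℕ → Bool

  below atLeast : ℕ → Row
  below   t w = w <ᵇ t
  atLeast t w = not (w <ᵇ t)

  -- The k-th chip right of p is input number k + 2, since the chip `r` enters first, so its label
  -- has to be at least k + 2. Labels are one above the zero-based letters when smaller than `r` and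
  -- two above them otherwise, which gives the two cases; see `chip-≥`.
  threshold : ℕ → ℕ → ℕ
  threshold r k = if suc k <ᵇ r then suc k else k

  Fits : List Row → List ℕ → Set
  Fits = Pointwise (λ R w → R w ≡ true)

  chip : ℕ → ℕ → ℕ
  chip r w = label r (suc w)

  chip-≥ : ∀ r k w → suc (suc k) ≤ chip r w ⇔ atLeast (threshold r k) w ≡ true
  chip-≥ r k w with <ᵇ-case (suc k) r | <ᵇ-case (suc w) r
  ... | inj₁ (k<r , k≡) | inj₁ (w<r , w≡) rewrite k≡ | w≡ = mk⇔ (from <ᵇ-false ∘ s≤s⁻¹) (s≤s ∘ to <ᵇ-false)
  ... | inj₁ (k<r , k≡) | inj₂ (r≤w , w≡) rewrite k≡ | w≡ =
    mk⇔ (λ _ → from <ᵇ-false k<w) (λ _ → s≤s (≤-trans k<w (n≤1+n w)))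
    where
    k<w : suc k ≤ w
    k<w = s≤s⁻¹ (≤-trans k<r r≤w)
  ... | inj₂ (r≤k , k≡) | inj₁ (w<r , w≡) rewrite k≡ | w≡ =
    mk⇔ (λ h → ⊥-elim (<⇒≱ w<k (≤-trans (n≤1+n k) (s≤s⁻¹ h)))) (λ h → ⊥-elim (<⇒≱ w<k (to <ᵇ-false h)))
    where
    w<k : w < k
    w<k = s≤s⁻¹ (≤-trans w<r r≤k)
  ... | inj₂ (r≤k , k≡) | inj₂ (r≤w , w≡) rewrite k≡ | w≡ = mk⇔ (from <ᵇ-false ∘ s≤s⁻¹ ∘ s≤s⁻¹) (s≤s ∘ s≤s ∘ to <ᵇ-false)

  -- As `r ≤ suc m`, a chip with label below `r` meets every window bound, and so does its letter.
  -- Only letters shifted by two remain to be compared, and for them the bound does not mention `r`.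
  chip-≤ : ∀ {r m} i w → r ≤ suc m → suc (i + suc m) ≥ chip r w ⇔ below (suc (i + m)) w ≡ true
  chip-≤ {r} {m} i w r≤ with <ᵇ-case (suc w) r
  ... | inj₁ (w<r , w≡) rewrite w≡ = mk⇔ (λ _ → from <ᵇ-true w<) (λ _ → s≤s (≤-trans (n≤1+n w) (≤-trans w< (≤-reflexive (sym (+-suc i m))))))
    where
    w< : w < suc (i + m)
    w< = ≤-trans (s≤s⁻¹ (≤-trans w<r r≤)) (≤-trans (m≤n+m m i) (n≤1+n _))
  ... | inj₂ (_ , w≡) rewrite w≡ | +-suc i m = mk⇔ (from <ᵇ-true ∘ s≤s⁻¹) (s≤s ∘ to <ᵇ-true)

  chip-injective : ∀ r {v w} → chip r v ≡ chip r w → v ≡ w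
  chip-injective r {v} {w} eq with <ᵇ-case (suc v) r | <ᵇ-case (suc w) r
  ... | inj₁ (_ , v≡)   | inj₁ (_ , w≡)   rewrite v≡ | w≡ = suc-injective eq
  ... | inj₁ (v<r , v≡) | inj₂ (r≤w , w≡) rewrite v≡ | w≡ = ⊥-elim (<⇒≱ v<r (≤-trans r≤w (≤-trans (n≤1+n _) (≤-reflexive (sym eq)))))
  ... | inj₂ (r≤v , v≡) | inj₁ (w<r , w≡) rewrite v≡ | w≡ = ⊥-elim (<⇒≱ w<r (≤-trans r≤v (≤-trans (n≤1+n _) (≤-reflexive eq))))
  ... | inj₂ (_ , v≡)   | inj₂ (_ , w≡)   rewrite v≡ | w≡ = suc-injective (suc-injective eq)

  chip-≢ : ∀ r w → r ≢ chip r w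
  chip-≢ r w eq with <ᵇ-case (suc w) r
  ... | inj₁ (w<r , w≡) rewrite w≡ = <⇒≢ w<r (sym eq)
  ... | inj₂ (r≤w , w≡) rewrite w≡ = <⇒≢ (s≤s r≤w) eq

  chip-range : ∀ r {w n} → w < n → chip r w ∈ applyUpTo suc (suc n)
  chip-range r {w} {n} w<n with suc w <ᵇ r
  ... | true  = ∈-applyUpTo⁺ suc (≤-trans w<n (n≤1+n n))
  ... | false = ∈-applyUpTo⁺ suc (s≤s w<n)

  -- `topRows` begins at site p and goes left, like the window of the network; the `ʳ++` in `rows`
  -- restores the order of the sites.
  topRows bottomRows : ℕ → ℕ → List Row
  topRows    m p = applyDownFrom (λ i → below (suc (i + m))) p
  bottomRows r m = applyUpTo (λ k → atLeast (threshold r k)) m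

  rows : ℕ → ℕ → ℕ → List Row
  rows r m p = topRows m p ʳ++ bottomRows r m

  Pointwise-ʳ++⁻ : ∀ {A B : Set} {R : A → B → Set} (as : List A) (bs : List B) {cs ds} → length as ≡ length bs →
                   Pointwise R (as ʳ++ cs) (bs ʳ++ ds) → Pointwise R as bs × Pointwise R cs ds
  Pointwise-ʳ++⁻ []       []       len h = [] , h
  Pointwise-ʳ++⁻ (a ∷ as) (b ∷ bs) len h with Pointwise-ʳ++⁻ as bs (suc-injective len) h
  ... | as∼ , a∼ ∷ h′ = a∼ ∷ as∼ , h′

  Pointwise-map : ∀ {A B C D E : Set} {R : C → D → Set} {S : E → B → Set} (f : A → C) (g : B → D) (f′ : A → E) →
                  (∀ a b → R (f a) (g b) ⇔ S (f′ a) b) → ∀ as bs →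
                  Pointwise R (map f as) (map g bs) ⇔ Pointwise S (map f′ as) bs
  Pointwise-map {R = R} {S} f g f′ h as bs = mk⇔ (⇒ as bs) (⇐ as bs)
    where
    ⇒ : ∀ as bs → Pointwise R (map f as) (map g bs) → Pointwise S (map f′ as) bs
    ⇒ []       []       []      = []
    ⇒ (a ∷ as) (b ∷ bs) (x ∷ p) = to (h a b) x ∷ ⇒ as bs p
    ⇐ : ∀ as bs → Pointwise S (map f′ as) bs → Pointwise R (map f as) (map g bs)
    ⇐ []       []       []      = []
    ⇐ (a ∷ as) (b ∷ bs) (x ∷ p) = from (h a b) x ∷ ⇐ as bs p

  unwind : ∀ {A : Set} k (xs : List A) → k ≤ length xs → ∃₂ λ us vs → xs ≡ us ʳ++ vs × length us ≡ k
  unwind zero    xs       _ = [] , xs , refl , refl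
  unwind (suc k) xs       k< with unwind k xs (≤-trans (n≤1+n k) k<)
  ... | us , v ∷ vs , refl , refl = v ∷ us , vs , refl , refl
  ... | us , []     , refl , refl = ⊥-elim (<⇒≱ k< (≤-reflexive (≡.trans (length-ʳ++ us) (+-identityʳ (length us)))))

  letters : ∀ {n k} → Vec (Fin n) k → List ℕ
  letters π = map toℕ (toList π)

  module _ (m p : ℕ) (r : ℕ) (1≤r : 1 ≤ r) (r≤ : r ≤ suc m) (π : Vec (Fin (m + suc p)) (m + suc p)) (perm : isPerm π ≡ true) where

    private
      n = m + suc p
      ws = letters π

      chips≡ : chips r π ≡ map (chip r) ws
      chips≡ = map-∘ (toList π)

      len-ws : length ws ≡ n
      len-ws = ≡.trans (length-map toℕ (toList π)) (length-toList π)

      unique-ws : Unique ws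
      unique-ws = to (distinct-true ws) perm

      unique : Unique (r ∷ chips r π)
      unique = subst (λ xs → Unique (r ∷ xs)) (sym chips≡)
        (tabulate r≢ ∷ Unique.map⁺ (chip-injective r) unique-ws)
        where
        r≢ : ∀ {x} → x ∈ map (chip r) ws → r ≢ x
        r≢ x∈ with ∈-map⁻ (chip r) x∈
        ... | w , _ , refl = chip-≢ r w

      all-labels : r ∷ chips r π ↭ applyUpTo suc (suc n)
      all-labels = pigeonhole unique range (≤-reflexive (≡.trans (length-applyUpTo suc (suc n)) (cong suc (sym (≡.trans (cong length chips≡) (≡.trans (length-map (chip r) ws) len-ws))))))
        where
        r∈ : ∀ {r} → 1 ≤ r → r ≤ suc m → r ∈ applyUpTo suc (suc n)
        r∈ (s≤s _) (s≤s r≤m) = ∈-applyUpTo⁺ suc (s≤s (≤-trans r≤m (m≤m+n m (suc p))))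
        range : ∀ {x} → x ∈ r ∷ chips r π → x ∈ applyUpTo suc (suc n)
        range (here refl) = r∈ 1≤r r≤
        range (there x∈) with ∈-map⁻ _ x∈
        ... | v , _ , refl = chip-range r (toℕ<n v)

    toppleable⇔fits : toppleable r (suc p) π ≡ true ⇔ Fits (rows r m (suc p)) ws
    toppleable⇔fits with unwind (suc p) ws (≤-trans (m≤n+m (suc p) m) (≤-reflexive (sym len-ws)))
    ... | u ∷ us , vs , ws≡ , len-us = mk⇔ ⇒ ⇐
      where
      ch = chip r
      split : chips r π ≡ map ch us ʳ++ (ch u ∷ map ch vs)
      split = ≡.trans chips≡ (≡.trans (cong (map ch) ws≡) (map-ʳ++ ch us))
      len-us′ : length (map ch us) ≡ p
      len-us′ = ≡.trans (length-map ch us) (suc-injective len-us)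
      len-vs : length vs ≡ m
      len-vs = +-cancelʳ-≡ (suc p) (length vs) m (begin
        length vs + suc p              ≡⟨ +-comm (length vs) (suc p) ⟩
        suc p + length vs              ≡⟨ cong (_+ length vs) len-us ⟨
        length (u ∷ us) + length vs    ≡⟨ length-ʳ++ (u ∷ us) ⟨
        length ((u ∷ us) ʳ++ vs)       ≡⟨ cong length ws≡ ⟨
        length ws                      ≡⟨ len-ws ⟩
        m + suc p                      ∎)
        where open ≡-Reasoning
      open Network _⊓_ _⊔_
      ys cs : List ℕ
      ys = r ∷ map ch vs
      cs = map ch (u ∷ us)
      arranged : cs ++ ys ↭ applyUpTo suc (suc m + suc p)
      arranged = ↭-trans (shift r cs (map ch vs)) (↭-trans (prep r (↭-trans (++↭ʳ++ cs (map ch vs)) (↭-reflexive (sym split)))) all-labels)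
      open Sorted ys cs (suc p) (suc m) (cong suc (≡.trans (length-map ch vs) len-vs)) (cong suc len-us′) arranged
      outcome : toppleable r (suc p) π ≡ ⌊ ≡-dec _≟_ (outs ys cs ++ reverse (cols ys cs)) (idList n) ⌋
      outcome = subst (λ k → toppleable r (suc k) π ≡ ⌊ ≡-dec _≟_ (outs ys cs ++ reverse (cols ys cs)) (idList n) ⌋) len-us′
        (toppleable-outs r π (map ch us) (ch u) (map ch vs) split unique)
      idList≡ : idList n ≡ applyUpTo suc (suc n)
      idList≡ = map-upTo suc (suc n)
      bottom : Pointwise _≤_ (applyUpTo (suc ∘ suc) m) (map ch vs) ⇔ Fits (bottomRows r m) vs
      bottom rewrite sym (map-upTo (suc ∘ suc) m) | sym (map-upTo (λ k → atLeast (threshold r k)) m) =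
        Pointwise-map (suc ∘ suc) ch (λ k → atLeast (threshold r k)) (chip-≥ r) (upTo m) vs
      top : Pointwise _≥_ large cs ⇔ Fits (topRows m (suc p)) (u ∷ us)
      top rewrite sym (map-downFrom (λ i → suc (i + suc m)) (suc p)) | sym (map-downFrom (λ i → below (suc (i + m))) (suc p)) =
        Pointwise-map (λ i → suc (i + suc m)) ch (λ i → below (suc (i + m))) (λ i w → chip-≤ i w r≤) (downFrom (suc p)) (u ∷ us)
      sorted⇔ : toppleable r (suc p) π ≡ true ⇔ (outs ys cs ++ reverse (cols ys cs) ≡ applyUpTo suc (suc n))
      sorted⇔ = mk⇔ (λ t → ≡.trans (to isYes-true (≡.trans (sym outcome) t)) idList≡)
                    (λ eq → ≡.trans outcome (from isYes-true (≡.trans eq (sym idList≡))))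
      ⇒ : toppleable r (suc p) π ≡ true → Fits (rows r m (suc p)) ws
      ⇒ t = let bounds = sorted⇒bounded (to sorted⇔ t) in
        subst (Fits _) (sym ws≡) (Pointwise.ʳ++⁺ (to top (proj₂ bounds)) (to bottom (Pointwise.tail (proj₁ bounds))))
      ⇐ : Fits (rows r m (suc p)) ws → toppleable r (suc p) π ≡ true
      ⇐ f with Pointwise-ʳ++⁻ (topRows m (suc p)) (u ∷ us) (≡.trans (length-applyDownFrom _ (suc p)) (sym len-us)) (subst (Fits _) ws≡ f)
      -- The first input is the chip `r` itself, whose bound is 1.
      ... | a , b = from sorted⇔ (bounded⇒sorted (1≤r ∷ from bottom b) (from top a))

  remove : ℕ → List ℕ → List ℕ
  remove w = filter (λ x → ¬? (w ≟ x))

  -- Tests distinctness and the row conditions together by drawing each letter from a shrinking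
  -- pool. This is the shape of the expansion of a permanent along its first row.
  fills : List Row → List ℕ → List ℕ → Bool
  fills []       xs []       = true
  fills []       xs (_ ∷ _)  = false
  fills (R ∷ Rs) xs []       = false
  fills (R ∷ Rs) xs (w ∷ ws) = (member w xs ∧ R w) ∧ fills Rs (remove w xs) ws

  fills-true : ∀ Rs xs ws → fills Rs xs ws ≡ true ⇔ (Fits Rs ws × Unique ws × (∀ {w} → w ∈ ws → w ∈ xs))
  fills-true Rs xs ws = mk⇔ (⇒ Rs xs ws) (λ (f , u , s) → ⇐ xs f u s)
    where
    ⇒ : ∀ Rs xs ws → fills Rs xs ws ≡ true → Fits Rs ws × Unique ws × (∀ {w} → w ∈ ws → w ∈ xs)
    ⇒ []       xs []       refl = [] , [] , λ ()
    ⇒ (R ∷ Rs) xs (w ∷ ws) h with ∧-true {member w xs ∧ R w} h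
    ... | h₁ , h₂ with ∧-true {member w xs} h₁ | ⇒ Rs (remove w xs) ws h₂
    ...   | w∈ , Rw | f , u , s = Rw ∷ f , tabulate (λ { z∈ refl → proj₂ (kept z∈) refl }) ∷ u ,
            λ { (here refl) → to (member-true xs) w∈ ; (there z∈) → proj₁ (kept z∈) }
      where
      kept : ∀ {z} → z ∈ ws → z ∈ xs × w ≢ z
      kept z∈ = ∈-filter⁻ (λ x → ¬? (w ≟ x)) (s z∈)
    ⇐ : ∀ {Rs ws} xs → Fits Rs ws → Unique ws → (∀ {w} → w ∈ ws → w ∈ xs) → fills Rs xs ws ≡ true
    ⇐ xs []       u        s = refl
    ⇐ {R ∷ Rs} {w ∷ ws} xs (Rw ∷ f) (w∉ ∷ u) s
      rewrite from (member-true xs) (s (here refl)) | Rw =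
      ⇐ (remove w xs) f u (λ z∈ → ∈-filter⁺ (λ x → ¬? (w ≟ x)) (s (there z∈)) (lookup w∉ z∈))

  toppleable-fills : ∀ m p r → 1 ≤ r → r ≤ suc m → (π : Vec (Fin (m + suc p)) (m + suc p)) →
                     isPerm π ∧ toppleable r (suc p) π ≡ fills (rows r m (suc p)) (upTo (m + suc p)) (letters π)
  toppleable-fills m p r 1≤r r≤ π = bool-ext ⇒ ⇐
    where
    Rs = rows r m (suc p)
    ws⊆ : ∀ {w} → w ∈ letters π → w ∈ upTo (m + suc p)
    ws⊆ w∈ with ∈-map⁻ toℕ w∈
    ... | v , _ , refl = ∈-upTo⁺ (toℕ<n v)
    ⇒ : isPerm π ∧ toppleable r (suc p) π ≡ true → fills Rs (upTo (m + suc p)) (letters π) ≡ true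
    ⇒ h with ∧-true {isPerm π} h
    ... | perm , t = from (fills-true Rs _ (letters π)) (to (toppleable⇔fits m p r 1≤r r≤ π perm) t , to (distinct-true _) perm , ws⊆)
    ⇐ : fills Rs (upTo (m + suc p)) (letters π) ≡ true → isPerm π ∧ toppleable r (suc p) π ≡ true
    ⇐ h with to (fills-true Rs _ (letters π)) h
    ... | f , u , _ = cong₂ _∧_ perm (from (toppleable⇔fits m p r 1≤r r≤ π perm) f)
      where
      perm : isPerm π ≡ true
      perm = from (distinct-true _) u

open Criterion

-- Permanents of matrices with threshold rows.

module Permanents where
  open import Data.Rational using (_+_; _*_; -_; _-_)

  -- Since `_/_` normalises its result, identities between such fractions are checked among
  -- unnormalised rationals and transported back.
  toℚᵘ-ℕtoℚ : ∀ a → toℚᵘ (ℕtoℚ a) ℚᵘ.≃ ℚᵘ.mkℚᵘ (ℤ.+ a) 0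
  toℚᵘ-ℕtoℚ a = toℚᵘ-fromℚᵘ (ℚᵘ.mkℚᵘ (ℤ.+ a) 0)

  ℕtoℚ-+ : ∀ a b → ℕtoℚ (a ℕ.+ b) ≡ ℕtoℚ a + ℕtoℚ b
  ℕtoℚ-+ a b = toℚᵘ-injective (begin
    toℚᵘ (ℕtoℚ (a ℕ.+ b))                    ≈⟨ toℚᵘ-ℕtoℚ (a ℕ.+ b) ⟩
    ℚᵘ.mkℚᵘ (ℤ.+ (a ℕ.+ b)) 0                  ≈⟨ ℚᵘ.*≡* (cong (ℤ._* ℤ.+ 1) (sym (cong₂ ℤ._+_ (ℤP.*-identityʳ (ℤ.+ a)) (ℤP.*-identityʳ (ℤ.+ b))))) ⟩
    ℚᵘ.mkℚᵘ (ℤ.+ a) 0 ℚᵘ.+ ℚᵘ.mkℚᵘ (ℤ.+ b) 0     ≈⟨ ℚᵘP.+-cong (toℚᵘ-ℕtoℚ a) (toℚᵘ-ℕtoℚ b) ⟨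
    toℚᵘ (ℕtoℚ a) ℚᵘ.+ toℚᵘ (ℕtoℚ b)         ≈⟨ toℚᵘ-homo-+ (ℕtoℚ a) (ℕtoℚ b) ⟨
    toℚᵘ (ℕtoℚ a + ℕtoℚ b)                   ∎)
    where open ℚᵘP.≃-Reasoning

  ℕtoℚ-* : ∀ a b → ℕtoℚ (a ℕ.* b) ≡ ℕtoℚ a * ℕtoℚ b
  ℕtoℚ-* a b = toℚᵘ-injective (begin
    toℚᵘ (ℕtoℚ (a ℕ.* b))                    ≈⟨ toℚᵘ-ℕtoℚ (a ℕ.* b) ⟩
    ℚᵘ.mkℚᵘ (ℤ.+ (a ℕ.* b)) 0                  ≈⟨ ℚᵘ.*≡* (cong (ℤ._* ℤ.+ 1) (ℤP.pos-* a b)) ⟩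
    ℚᵘ.mkℚᵘ (ℤ.+ a) 0 ℚᵘ.* ℚᵘ.mkℚᵘ (ℤ.+ b) 0     ≈⟨ ℚᵘP.*-cong (toℚᵘ-ℕtoℚ a) (toℚᵘ-ℕtoℚ b) ⟨
    toℚᵘ (ℕtoℚ a) ℚᵘ.* toℚᵘ (ℕtoℚ b)         ≈⟨ toℚᵘ-homo-* (ℕtoℚ a) (ℕtoℚ b) ⟨
    toℚᵘ (ℕtoℚ a * ℕtoℚ b)                   ∎)
    where open ℚᵘP.≃-Reasoning

  ℕtoℚ-suc : ∀ a → ℕtoℚ (suc a) ≡ 1ℚ + ℕtoℚ a
  ℕtoℚ-suc = ℕtoℚ-+ 1

  -- The sum over all ways to pick one entry, the other entries being passed on in their order, as
  -- in a Laplace expansion.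
  sel : (ℕ → List ℕ → ℚ) → List ℕ → ℚ
  sel f []       = 0ℚ
  sel f (x ∷ xs) = f x xs + sel (λ y ys → f y (x ∷ ys)) xs

  sel-cong : ∀ {f g} xs → (∀ x ys → xs ↭ x ∷ ys → f x ys ≡ g x ys) → sel f xs ≡ sel g xs
  sel-cong []       f≡g = refl
  sel-cong (x ∷ xs) f≡g = cong₂ _+_ (f≡g x xs refl)
    (sel-cong xs (λ y ys p → f≡g y (x ∷ ys) (↭-trans (prep x p) (swap x y refl))))

  sel-+ : ∀ f g xs → sel (λ x ys → f x ys + g x ys) xs ≡ sel f xs + sel g xs
  sel-+ f g []       = refl
  sel-+ f g (x ∷ xs) = ≡.trans (cong ((f x xs + g x xs) +_) (sel-+ _ _ xs))
    (solve 4 (λ a b c d → (a :+ b) :+ (c :+ d) := (a :+ c) :+ (b :+ d)) refl (f x xs) (g x xs) _ _)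

  sel-*ˡ : ∀ c f xs → sel (λ x ys → c * f x ys) xs ≡ c * sel f xs
  sel-*ˡ c f []       = sym (ℚP.*-zeroʳ c)
  sel-*ˡ c f (x ∷ xs) = ≡.trans (cong ((c * f x xs) +_) (sel-*ˡ c _ xs)) (sym (ℚP.*-distribˡ-+ c _ _))

  -- Both sides run over the ordered pairs of distinct positions, and the list left over does not
  -- depend on which was picked first. This lets two rows of a permanent change places.
  sel-comm : ∀ (h : ℕ → ℕ → List ℕ → ℚ) xs →
             sel (λ x ys → sel (h x) ys) xs ≡ sel (λ x ys → sel (λ y → h y x) ys) xs
  sel-comm h []       = refl
  sel-comm h (a ∷ xs) = begin
    sel (h a) xs + sel (λ x ys → h x a ys + sel (λ y zs → h x y (a ∷ zs)) ys) xs
      ≡⟨ cong (sel (h a) xs +_) (sel-+ _ _ xs) ⟩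
    sel (h a) xs + (sel (λ x → h x a) xs + sel (λ x ys → sel (λ y zs → h x y (a ∷ zs)) ys) xs)
      ≡⟨ cong (λ q → sel (h a) xs + (sel (λ x → h x a) xs + q)) (sel-comm (λ x y zs → h x y (a ∷ zs)) xs) ⟩
    sel (h a) xs + (sel (λ x → h x a) xs + sel (λ x ys → sel (λ y zs → h y x (a ∷ zs)) ys) xs)
      ≡⟨ solve 3 (λ p q r → p :+ (q :+ r) := q :+ (p :+ r)) refl (sel (h a) xs) (sel (λ x → h x a) xs) (sel (λ x ys → sel (λ y zs → h y x (a ∷ zs)) ys) xs) ⟩
    sel (λ x → h x a) xs + (sel (h a) xs + sel (λ x ys → sel (λ y zs → h y x (a ∷ zs)) ys) xs)
      ≡⟨ cong (sel (λ x → h x a) xs +_) (sel-+ _ _ xs) ⟨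
    sel (λ x → h x a) xs + sel (λ x ys → h a x ys + sel (λ y zs → h y x (a ∷ zs)) ys) xs
      ∎
    where open ≡-Reasoning

  -- The permanent of the matrix with the given rows and with columns indexed by the letters.
  per : List (ℕ → ℚ) → List ℕ → ℚ
  per []       xs = 1ℚ
  per (f ∷ fs) xs = sel (λ x ys → f x * per fs ys) xs

  per-↭ : ∀ {fs gs} → fs ↭ gs → ∀ xs → per fs xs ≡ per gs xs
  per-↭ refl          xs = refl
  per-↭ (trans p q)   xs = ≡.trans (per-↭ p xs) (per-↭ q xs)
  per-↭ (prep f p)    xs = sel-cong xs (λ x ys _ → cong (f x *_) (per-↭ p ys))
  per-↭ {_ ∷ _ ∷ fs} {_ ∷ _ ∷ gs} (swap f g p) xs = begin
    sel (λ x ys → f x * sel (λ y zs → g y * per fs zs) ys) xs    ≡⟨ sel-cong xs (λ x ys _ → sym (sel-*ˡ (f x) _ ys)) ⟩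
    sel (λ x ys → sel (λ y zs → f x * (g y * per fs zs)) ys) xs  ≡⟨ sel-comm _ xs ⟩
    sel (λ x ys → sel (λ y zs → f y * (g x * per fs zs)) ys) xs  ≡⟨ sel-cong xs (λ x ys _ → sel-cong ys (λ y zs _ → ≡.trans
        (solve 3 (λ a b c → a :* (b :* c) := b :* (a :* c)) refl (f y) (g x) (per fs zs)) (cong (λ w → g x * (f y * w)) (per-↭ p zs)))) ⟩
    sel (λ x ys → sel (λ y zs → g x * (f y * per gs zs)) ys) xs   ≡⟨ sel-cong xs (λ x ys _ → sel-*ˡ (g x) _ ys) ⟩
    sel (λ x ys → g x * sel (λ y zs → f y * per gs zs) ys) xs     ∎
    where open ≡-Reasoning

  per-+ : ∀ {f g h} fs xs → (∀ x → f x ≡ g x + h x) → per (f ∷ fs) xs ≡ per (g ∷ fs) xs + per (h ∷ fs) xs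
  per-+ {f} {g} {h} fs xs f≡ = ≡.trans
    (sel-cong xs (λ x ys _ → ≡.trans (cong (_* per fs ys) (f≡ x)) (ℚP.*-distribʳ-+ (per fs ys) (g x) (h x))))
    (sel-+ _ _ xs)

  indicator : Row → ℕ → ℚ
  indicator R w = if R w then 1ℚ else 0ℚ

  one : ℕ → ℚ
  one = const 1ℚ

  count : ℕ → List ℕ → ℕ
  count t xs = length (filter (_<? t) xs)

  sel-const : ∀ w xs → sel (λ _ _ → w) xs ≡ ℕtoℚ (length xs) * w
  sel-const w []       = sym (ℚP.*-zeroˡ w)
  sel-const w (x ∷ xs) = begin
    w + sel (λ _ _ → w) xs            ≡⟨ cong₂ _+_ (sym (ℚP.*-identityˡ w)) (sel-const w xs) ⟩
    1ℚ * w + ℕtoℚ (length xs) * w     ≡⟨ ℚP.*-distribʳ-+ w 1ℚ (ℕtoℚ (length xs)) ⟨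
    (1ℚ + ℕtoℚ (length xs)) * w       ≡⟨ cong (_* w) (ℕtoℚ-suc (length xs)) ⟨
    ℕtoℚ (suc (length xs)) * w        ∎
    where open ≡-Reasoning

  sel-below-const : ∀ t w xs → sel (λ x _ → indicator (below t) x * w) xs ≡ ℕtoℚ (count t xs) * w
  sel-below-const t w []       = sym (ℚP.*-zeroˡ w)
  sel-below-const t w (x ∷ xs) with x <? t
  ... | yes x<t = begin
    indicator (below t) x * w + sel (λ y _ → indicator (below t) y * w) xs
      ≡⟨ cong₂ (λ b s → (if b then 1ℚ else 0ℚ) * w + s) (<ᵇ-yes x<t) (sel-below-const t w xs) ⟩
    1ℚ * w + ℕtoℚ (count t xs) * w
      ≡⟨ ℚP.*-distribʳ-+ w 1ℚ (ℕtoℚ (count t xs)) ⟨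
    (1ℚ + ℕtoℚ (count t xs)) * w
      ≡⟨ cong (_* w) (ℕtoℚ-suc (count t xs)) ⟨
    ℕtoℚ (suc (count t xs)) * w
      ≡⟨ cong (λ ys → ℕtoℚ (length ys) * w) (filter-accept (_<? t) x<t) ⟨
    ℕtoℚ (count t (x ∷ xs)) * w ∎
    where open ≡-Reasoning
  ... | no x≮t = begin
    indicator (below t) x * w + sel (λ y _ → indicator (below t) y * w) xs
      ≡⟨ cong₂ (λ b s → (if b then 1ℚ else 0ℚ) * w + s) (<ᵇ-no x≮t) (sel-below-const t w xs) ⟩
    0ℚ * w + ℕtoℚ (count t xs) * w
      ≡⟨ cong (_+ ℕtoℚ (count t xs) * w) (ℚP.*-zeroˡ w) ⟩
    0ℚ + ℕtoℚ (count t xs) * w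
      ≡⟨ ℚP.+-identityˡ _ ⟩
    ℕtoℚ (count t xs) * w
      ≡⟨ cong (λ ys → ℕtoℚ (length ys) * w) (filter-reject (_<? t) x≮t) ⟨
    ℕtoℚ (count t (x ∷ xs)) * w ∎
    where open ≡-Reasoning

  -- The greedy step: if the remaining rows have the same permanent whichever letter below `t` is
  -- removed, only the number of such letters matters.
  per-below : ∀ t fs xs w → (∀ x ys → xs ↭ x ∷ ys → x < t → per fs ys ≡ w) →
              per (indicator (below t) ∷ fs) xs ≡ ℕtoℚ (count t xs) * w
  per-below t fs xs w value = ≡.trans (sel-cong xs each) (sel-below-const t w xs)
    where
    each : ∀ x ys → xs ↭ x ∷ ys → indicator (below t) x * per fs ys ≡ indicator (below t) x * w
    each x ys p with x <? t
    ... | yes x<t = cong (indicator (below t) x *_) (value x ys p x<t)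
    ... | no  x≮t rewrite <ᵇ-no x≮t = ≡.trans (ℚP.*-zeroˡ (per fs ys)) (sym (ℚP.*-zeroˡ w))

  per-ones : ∀ i xs → length xs ≡ i → per (replicate i one) xs ≡ ℕtoℚ (i !)
  per-ones zero    xs len = refl
  per-ones (suc i) xs len = begin
    sel (λ x ys → 1ℚ * per (replicate i one) ys) xs  ≡⟨ sel-cong xs (λ x ys p → ≡.trans (ℚP.*-identityˡ _)
        (per-ones i ys (ℕP.suc-injective (≡.trans (sym (↭-length p)) len)))) ⟩
    sel (λ _ _ → ℕtoℚ (i !)) xs                      ≡⟨ sel-const _ xs ⟩
    ℕtoℚ (length xs) * ℕtoℚ (i !)                    ≡⟨ cong (λ l → ℕtoℚ l * ℕtoℚ (i !)) len ⟩
    ℕtoℚ (suc i) * ℕtoℚ (i !)                        ≡⟨ ℕtoℚ-* (suc i) (i !) ⟨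
    ℕtoℚ (suc i !)                                   ∎
    where open ≡-Reasoning

  -- xs arises from the letters 0, …, n - 1 by deleting j letters smaller than k.
  record Remaining (n j k : ℕ) (xs : List ℕ) : Set where
    constructor remaining
    field
      counts  : ∀ t → k ≤ t → t ≤ n → count t xs ℕ.+ j ≡ t
      amounts : length xs ℕ.+ j ≡ n
  open Remaining

  weaken : ∀ {n j k l xs} → k ≤ l → Remaining n j k xs → Remaining n j l xs
  weaken k≤l (remaining c a) = remaining (λ t l≤t → c t (ℕP.≤-trans k≤l l≤t)) a

  delete : ∀ {n j k xs x ys} → Remaining n j k xs → xs ↭ x ∷ ys → x < k → Remaining n (suc j) k ys
  delete {n} {j} {k} {xs} {x} {ys} (remaining c a) p x<k = remaining
    (λ t k≤t t≤n → ≡.trans (ℕP.+-suc (count t ys) j) (≡.trans (cong (ℕ._+ j) (sym (count-∷ t (ℕP.<-≤-trans x<k k≤t)))) (c t k≤t t≤n)))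
    (≡.trans (ℕP.+-suc _ j) (≡.trans (cong (ℕ._+ j) (sym (↭-length p))) a))
    where
    count-∷ : ∀ t → x < t → count t xs ≡ suc (count t ys)
    count-∷ t x<t = ≡.trans (↭-length (filter-↭ (_<? t) p)) (cong length (filter-accept (_<? t) x<t))

  -- Evaluates the permanent once k rows have been treated: j of them by letters below their
  -- threshold, while for i others the choice, now unrestricted, has been postponed.
  record Value (n k : ℕ) (fs : List (ℕ → ℚ)) (F : ℕ → ℚ) : Set where
    constructor valued
    field
      evaluate : ∀ j i xs → Remaining n j k xs → j ℕ.+ i ≡ k → per (fs ++ replicate i one) xs ≡ ℕtoℚ (i !) * F i
  open Value

  -- Below `t` there remain t - j letters, which is t - k + i because j = k - i. The count thus
  -- depends on `i` but not on `j`, so that in `Value` the function `F` needs only the argument `i`.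
  -- The equation for `c` is stated without subtraction.
  count-left : ∀ {n j k i xs t c} → Remaining n j k xs → j ℕ.+ i ≡ k → k ≤ t → t ≤ n → c ℕ.+ k ≡ i ℕ.+ t → count t xs ≡ c
  count-left {n} {j} {k} {i} {xs} {t} {c} rem j+i k≤t t≤n c+k = ℕP.+-cancelʳ-≡ k _ _ (begin
    count t xs ℕ.+ k             ≡⟨ cong (count t xs ℕ.+_) j+i ⟨
    count t xs ℕ.+ (j ℕ.+ i)     ≡⟨ ℕP.+-assoc (count t xs) j i ⟨
    count t xs ℕ.+ j ℕ.+ i       ≡⟨ cong (ℕ._+ i) (counts rem t k≤t t≤n) ⟩
    t ℕ.+ i                      ≡⟨ ℕP.+-comm t i ⟩
    i ℕ.+ t                      ≡⟨ c+k ⟨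
    c ℕ.+ k                      ∎)
    where open ≡-Reasoning

  -- Every row has threshold one above its index and so offers i + 1 letters. At the end exactly `i`
  -- letters are left for the `i` postponed rows, in i! ways.
  Value-below : ∀ {n} p k → k ℕ.+ p ≡ n → Value n k (map (indicator ∘ below) (iterate suc (suc k) p)) (λ i → ℕtoℚ (suc i ^ p))
  Value-below {n} zero k k≡n = valued λ j i xs rem j+i → ≡.trans (per-ones i xs (ℕP.+-cancelʳ-≡ j _ _ (≡.trans (amounts rem)
    (≡.trans (sym k≡n) (≡.trans (ℕP.+-identityʳ k) (≡.trans (sym j+i) (ℕP.+-comm j i))))))) (sym (ℚP.*-identityʳ _))
  Value-below {n} (suc p) k k+p = valued λ j i xs rem j+i → begin
    per (indicator (below (suc k)) ∷ map (indicator ∘ below) (iterate suc (suc (suc k)) p) ++ replicate i one) xs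
      ≡⟨ per-below (suc k) (map (indicator ∘ below) (iterate suc (suc (suc k)) p) ++ replicate i one) xs _ (λ x ys π x<k → evaluate (Value-below p (suc k) (≡.trans (sym (ℕP.+-suc k p)) k+p)) (suc j) i ys
           (delete (weaken (ℕP.n≤1+n k) rem) π x<k) (cong suc j+i)) ⟩
    ℕtoℚ (count (suc k) xs) * (ℕtoℚ (i !) * ℕtoℚ (suc i ^ p))
      ≡⟨ cong (λ c → ℕtoℚ c * (ℕtoℚ (i !) * ℕtoℚ (suc i ^ p))) (count-left rem j+i (ℕP.n≤1+n k) k<n (sym (ℕP.+-suc i k))) ⟩
    ℕtoℚ (suc i) * (ℕtoℚ (i !) * ℕtoℚ (suc i ^ p))
      ≡⟨ solve 3 (λ a b c → a :* (b :* c) := b :* (a :* c)) refl (ℕtoℚ (suc i)) (ℕtoℚ (i !)) (ℕtoℚ (suc i ^ p)) ⟩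
    ℕtoℚ (i !) * (ℕtoℚ (suc i) * ℕtoℚ (suc i ^ p))
      ≡⟨ cong (ℕtoℚ (i !) *_) (ℕtoℚ-* (suc i) (suc i ^ p)) ⟨
    ℕtoℚ (i !) * ℕtoℚ (suc i ^ suc p) ∎
    where
    open ≡-Reasoning
    k<n : suc k ≤ n
    k<n = ℕP.≤-trans (ℕP.m≤m+n (suc k) p) (ℕP.≤-reflexive (≡.trans (sym (ℕP.+-suc k p)) k+p))

  -- The row equals `one` minus `below t`. The row `one` is postponed, turning i! into (i + 1)! and
  -- `F i` into `F (suc i)`; the row `below t` is filled at once by one of `c i` letters and leaves
  -- `i` unchanged.
  Value-atLeast : ∀ {n k t fs F} (c : ℕ → ℕ) → k ≤ t → t ≤ suc k → suc k ≤ n → (∀ i → c i ℕ.+ k ≡ i ℕ.+ t) → Value n (suc k) fs F →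
                  Value n k (indicator (atLeast t) ∷ fs) (λ i → ℕtoℚ (suc i) * F (suc i) - ℕtoℚ (c i) * F i)
  Value-atLeast {n} {k} {t} {fs} {F} c k≤t t≤k k<n c≡ value = valued evaluate-atLeast
    where
    evaluate-atLeast : ∀ j i xs → Remaining n j k xs → j ℕ.+ i ≡ k →
                       per (indicator (atLeast t) ∷ fs ++ replicate i one) xs ≡ ℕtoℚ (i !) * (ℕtoℚ (suc i) * F (suc i) - ℕtoℚ (c i) * F i)
    evaluate-atLeast j i xs rem j+i = begin
      per (indicator (atLeast t) ∷ gs) xs
        ≡⟨ solve 2 (λ a b → a := (b :+ a) :- b) refl (per (indicator (atLeast t) ∷ gs) xs) (per (indicator (below t) ∷ gs) xs) ⟩
      (per (indicator (below t) ∷ gs) xs + per (indicator (atLeast t) ∷ gs) xs) - per (indicator (below t) ∷ gs) xs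
        ≡⟨ cong₂ _-_ (sym (per-+ {one} {indicator (below t)} {indicator (atLeast t)} gs xs complement)) below-part ⟩
      per (one ∷ gs) xs - ℕtoℚ (c i) * (ℕtoℚ (i !) * F i)
        ≡⟨ cong (_- ℕtoℚ (c i) * (ℕtoℚ (i !) * F i)) free-part ⟩
      ℕtoℚ (suc i) * ℕtoℚ (i !) * F (suc i) - ℕtoℚ (c i) * (ℕtoℚ (i !) * F i)
        ≡⟨ solve 5 (λ a b c x y → a :* b :* x :- c :* (b :* y) := b :* (a :* x :- c :* y)) refl (ℕtoℚ (suc i)) (ℕtoℚ (i !)) (ℕtoℚ (c i)) (F (suc i)) (F i) ⟩
      ℕtoℚ (i !) * (ℕtoℚ (suc i) * F (suc i) - ℕtoℚ (c i) * F i) ∎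
      where
      open ≡-Reasoning
      gs = fs ++ replicate i one
      t≤n = ℕP.≤-trans t≤k k<n
      complement : ∀ x → 1ℚ ≡ indicator (below t) x + indicator (atLeast t) x
      complement x with x <ᵇ t
      ... | true  = refl
      ... | false = refl
      below-part : per (indicator (below t) ∷ gs) xs ≡ ℕtoℚ (c i) * (ℕtoℚ (i !) * F i)
      below-part = ≡.trans
        (per-below t gs xs _ (λ x ys π x<t → evaluate value (suc j) i ys (weaken t≤k (delete (weaken k≤t rem) π x<t)) (cong suc j+i)))
        (cong (λ l → ℕtoℚ l * (ℕtoℚ (i !) * F i)) (count-left rem j+i k≤t t≤n (c≡ i)))
      free-part : per (one ∷ gs) xs ≡ ℕtoℚ (suc i) * ℕtoℚ (i !) * F (suc i)
      -- Postponing the choice means moving the row of ones past `fs` to the other rows of ones.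
      free-part = ≡.trans (per-↭ (↭-sym (shift one fs (replicate i one))) xs)
        (≡.trans (evaluate value j (suc i) xs (weaken (ℕP.n≤1+n k) rem) (≡.trans (ℕP.+-suc j i) (cong suc j+i)))
                 (cong (_* F (suc i)) (ℕtoℚ-* (suc i) (i !))))

  -- Adjoint to a ↦ (i ↦ i (aᵢ₋₁ − aᵢ)), the recursion satisfied by n! [xⁿ] (1 − e⁻ˣ)ⁱ.
  𝒜 Δ𝒜 : (ℕ → ℚ) → ℕ → ℚ
  𝒜  F i = ℕtoℚ (suc i) * F (suc i) - ℕtoℚ i * F i
  Δ𝒜 F i = 𝒜 F i - F i

  bottoms : ℕ → ℕ → List (ℕ → ℚ)
  bottoms k s = map (indicator ∘ atLeast) (iterate suc k s)

  Value-cong : ∀ {n k fs F G} → F ≗ G → Value n k fs F → Value n k fs G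
  Value-cong F≗G value = valued λ j i xs rem j+i → ≡.trans (evaluate value j i xs rem j+i) (cong (ℕtoℚ (i !) *_) (F≗G i))

  Value-𝒜 : ∀ {n fs F} s k → k ℕ.+ s ≤ n → Value n (k ℕ.+ s) fs F → Value n k (bottoms k s ++ fs) (fold F 𝒜 s)
  Value-𝒜 {n} {fs} {F} zero k k≤ value = subst (λ l → Value n l fs F) (ℕP.+-identityʳ k) value
  Value-𝒜 {n} {fs} {F} (suc s) k k≤ value = Value-atLeast (λ i → i) ℕP.≤-refl (ℕP.n≤1+n k)
    (ℕP.≤-trans (ℕP.m≤m+n (suc k) s) (ℕP.≤-trans (ℕP.≤-reflexive (sym (ℕP.+-suc k s))) k≤)) (λ i → refl)
    (Value-𝒜 s (suc k) (subst (_≤ n) (ℕP.+-suc k s) k≤) (subst (λ l → Value n l fs F) (ℕP.+-suc k s) value))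

  -- Thresholds one above the row index offer i + 1 letters instead of i, and (i + 1)(F(i + 1) -
  -- F(i)) = `𝒜 F i - F i`.
  Value-Δ𝒜 : ∀ {n fs F} s k → k ℕ.+ s ≤ n → Value n (k ℕ.+ s) fs F → Value n k (bottoms (suc k) s ++ fs) (fold F Δ𝒜 s)
  Value-Δ𝒜 {n} {fs} {F} zero k k≤ value = subst (λ l → Value n l fs F) (ℕP.+-identityʳ k) value
  Value-Δ𝒜 {n} {fs} {F} (suc s) k k≤ value = Value-cong Δ𝒜-≗ (Value-atLeast suc (ℕP.n≤1+n k) ℕP.≤-refl
    (ℕP.≤-trans (ℕP.m≤m+n (suc k) s) (ℕP.≤-trans (ℕP.≤-reflexive (sym (ℕP.+-suc k s))) k≤)) (λ i → sym (ℕP.+-suc i k))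
    (Value-Δ𝒜 s (suc k) (subst (_≤ n) (ℕP.+-suc k s) k≤) (subst (λ l → Value n l fs F) (ℕP.+-suc k s) value)))
    where
    G = fold F Δ𝒜 s
    Δ𝒜-≗ : (λ i → ℕtoℚ (suc i) * G (suc i) - ℕtoℚ (suc i) * G i) ≗ Δ𝒜 G
    Δ𝒜-≗ i = ≡.trans (cong (λ c → ℕtoℚ (suc i) * G (suc i) - c * G i) (ℕtoℚ-suc i))
      (≡.trans (cong (λ q → ℕtoℚ (suc i) * G (suc i) - q) (≡.trans (ℚP.*-distribʳ-+ (G i) 1ℚ (ℕtoℚ i)) (cong (_+ ℕtoℚ i * G i) (ℚP.*-identityˡ (G i)))))
        (solve 3 (λ a b g → a :- (g :+ b) := a :- b :- g) refl (ℕtoℚ (suc i) * G (suc i)) (ℕtoℚ i * G i) (G i)))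

open Permanents

-- Counting words by permanents.

module Counting where
  open import Data.Rational using (_+_; _*_)

  sumFin : ∀ n → (Fin n → ℕ) → ℕ
  sumFin zero    f = 0
  sumFin (suc n) f = f fzero ℕ.+ sumFin n (f ∘ fsuc)

  countVec : ∀ {n} k → (Vec (Fin n) k → Bool) → ℕ
  countVec zero    Q = if Q [] then 1 else 0
  countVec (suc k) Q = sumFin _ (λ v → countVec k (Q ∘ (v ∷_)))

  Σ-Fin : ∀ n {P : Fin n → Set} (f : Fin n → ℕ) → (∀ v → P v ↔ Fin (f v)) → Σ (Fin n) P ↔ Fin (sumFin n f)
  Σ-Fin zero    f P↔ = mk↔ₛ′ (λ ()) (λ ()) (λ ()) (λ ())
  Σ-Fin (suc n) {P} f P↔ = ↔-sym +↔⊎ ↔-∘ ((P↔ fzero ⊎-↔ Σ-Fin n (f ∘ fsuc) (P↔ ∘ fsuc)) ↔-∘ split)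
    where
    split : Σ (Fin (suc n)) P ↔ (P fzero ⊎ Σ (Fin n) (P ∘ fsuc))
    split = mk↔ₛ′ (λ { (fzero , x) → inj₁ x ; (fsuc v , x) → inj₂ (v , x) })
                  (λ { (inj₁ x) → fzero , x ; (inj₂ (v , x)) → fsuc v , x })
                  (λ { (inj₁ x) → refl ; (inj₂ _) → refl })
                  (λ { (fzero , x) → refl ; (fsuc v , x) → refl })

  countVec-↔ : ∀ {n} k (Q : Vec (Fin n) k → Bool) → (Σ[ π ∈ Vec (Fin n) k ] Q π ≡ true) ↔ Fin (countVec k Q)
  countVec-↔ {n} zero Q = base (Q []) ↔-∘ nil
    where
    nil : (Σ[ π ∈ Vec (Fin n) 0 ] Q π ≡ true) ↔ (Q [] ≡ true)
    nil = mk↔ₛ′ (λ { ([] , q) → q }) (λ q → [] , q) (λ _ → refl) (λ { ([] , q) → refl })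
    base : ∀ b → (b ≡ true) ↔ Fin (if b then 1 else 0)
    base true  = mk↔ₛ′ (λ _ → fzero) (λ _ → refl) (λ { fzero → refl ; (fsuc ()) }) (λ { refl → refl })
    base false = mk↔ₛ′ (λ ()) (λ ()) (λ ()) (λ ())
  countVec-↔ {n} (suc k) Q = Σ-Fin n _ (λ v → countVec-↔ k (Q ∘ (v ∷_))) ↔-∘ uncons
    where
    uncons : (Σ[ π ∈ Vec (Fin n) (suc k) ] Q π ≡ true) ↔ Σ (Fin n) (λ v → Σ[ π ∈ Vec (Fin n) k ] Q (v ∷ π) ≡ true)
    uncons = mk↔ₛ′ (λ { (v ∷ π , q) → v , π , q }) (λ { (v , π , q) → v ∷ π , q }) (λ _ → refl) (λ { (v ∷ π , q) → refl })

  sumFin-cong : ∀ n {f g : Fin n → ℕ} → (∀ v → f v ≡ g v) → sumFin n f ≡ sumFin n g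
  sumFin-cong zero    f≡g = refl
  sumFin-cong (suc n) f≡g = cong₂ ℕ._+_ (f≡g fzero) (sumFin-cong n (f≡g ∘ fsuc))

  countVec-cong : ∀ {n} k {P Q : Vec (Fin n) k → Bool} → (∀ π → P π ≡ Q π) → countVec k P ≡ countVec k Q
  countVec-cong zero    P≡Q = cong (λ b → if b then 1 else 0) (P≡Q [])
  countVec-cong (suc k) P≡Q = sumFin-cong _ (λ v → countVec-cong k (λ π → P≡Q (v ∷ π)))

  sumFin-zero : ∀ n → sumFin n (λ _ → 0) ≡ 0
  sumFin-zero zero    = refl
  sumFin-zero (suc n) = sumFin-zero n

  countVec-false : ∀ {n} k → countVec {n} k (λ _ → false) ≡ 0
  countVec-false zero    = refl
  countVec-false {n} (suc k) = ≡.trans (sumFin-cong n (λ _ → countVec-false k)) (sumFin-zero n)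

  sumℚ : ∀ n → (Fin n → ℚ) → ℚ
  sumℚ zero    f = 0ℚ
  sumℚ (suc n) f = f fzero + sumℚ n (f ∘ fsuc)

  ℕtoℚ-sumFin : ∀ n f → ℕtoℚ (sumFin n f) ≡ sumℚ n (ℕtoℚ ∘ f)
  ℕtoℚ-sumFin zero    f = refl
  ℕtoℚ-sumFin (suc n) f = ≡.trans (ℕtoℚ-+ (f fzero) (sumFin n (f ∘ fsuc))) (cong (ℕtoℚ (f fzero) +_) (ℕtoℚ-sumFin n (f ∘ fsuc)))

  sumℚ-cong : ∀ n {f g : Fin n → ℚ} → (∀ v → f v ≡ g v) → sumℚ n f ≡ sumℚ n g
  sumℚ-cong zero    f≡g = refl
  sumℚ-cong (suc n) f≡g = cong₂ _+_ (f≡g fzero) (sumℚ-cong n (f≡g ∘ fsuc))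

  sumℚ-+ : ∀ n (f g : Fin n → ℚ) → sumℚ n (λ v → f v + g v) ≡ sumℚ n f + sumℚ n g
  sumℚ-+ zero    f g = refl
  sumℚ-+ (suc n) f g = ≡.trans (cong ((f fzero + g fzero) +_) (sumℚ-+ n (f ∘ fsuc) (g ∘ fsuc)))
    (solve 4 (λ a b c d → (a :+ b) :+ (c :+ d) := (a :+ c) :+ (b :+ d)) refl (f fzero) (g fzero) (sumℚ n (f ∘ fsuc)) (sumℚ n (g ∘ fsuc)))

  sumℚ-zero : ∀ n → sumℚ n (λ _ → 0ℚ) ≡ 0ℚ
  sumℚ-zero zero    = refl
  sumℚ-zero (suc n) = ≡.trans (cong (0ℚ +_) (sumℚ-zero n)) (ℚP.+-identityˡ 0ℚ)

  sumℚ-single : ∀ n x c → x < n → sumℚ n (λ v → if x ℕ.≡ᵇ toℕ v then c else 0ℚ) ≡ c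
  sumℚ-single (suc n) zero    c _         = ≡.trans (cong (c +_) (sumℚ-zero n)) (ℚP.+-identityʳ c)
  sumℚ-single (suc n) (suc x) c (s≤s x<n) = ≡.trans (ℚP.+-identityˡ _) (sumℚ-single n x c x<n)

  -- Without repetitions in `xs`, picking a value and picking a position are the same. The induction
  -- splits off the value `x`, which contributes the first term of `sel` and does not occur in the
  -- tail.
  sumℚ-sel : ∀ n (g : ℕ → List ℕ → ℚ) xs → Unique xs → All (_< n) xs →
             sumℚ n (λ v → if member (toℕ v) xs then g (toℕ v) (remove (toℕ v) xs) else 0ℚ) ≡ sel g xs
  sumℚ-sel n g []       u        xs<n         = sumℚ-zero n
  sumℚ-sel n g (x ∷ xs) (x∉ ∷ u) (x<n ∷ xs<n) = begin
    sumℚ n (λ v → if member (toℕ v) (x ∷ xs) then g (toℕ v) (remove (toℕ v) (x ∷ xs)) else 0ℚ)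
      ≡⟨ sumℚ-cong n (split ∘ toℕ) ⟩
    sumℚ n (λ v → (if x ℕ.≡ᵇ toℕ v then g x xs else 0ℚ) + (if member (toℕ v) xs then g (toℕ v) (x ∷ remove (toℕ v) xs) else 0ℚ))
      ≡⟨ sumℚ-+ n _ _ ⟩
    sumℚ n (λ v → if x ℕ.≡ᵇ toℕ v then g x xs else 0ℚ) + sumℚ n (λ v → if member (toℕ v) xs then g (toℕ v) (x ∷ remove (toℕ v) xs) else 0ℚ)
      ≡⟨ cong₂ _+_ (sumℚ-single n x (g x xs) x<n) (sumℚ-sel n (λ y ys → g y (x ∷ ys)) xs u xs<n) ⟩
    g x xs + sel (λ y ys → g y (x ∷ ys)) xs ∎
    where
    open ≡-Reasoning
    split : ∀ v → (if member v (x ∷ xs) then g v (remove v (x ∷ xs)) else 0ℚ)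
                ≡ (if x ℕ.≡ᵇ v then g x xs else 0ℚ) + (if member v xs then g v (x ∷ remove v xs) else 0ℚ)
    split v with v ≟ x
    ... | yes refl
      rewrite ≡ᵇ-refl v | ≢-true⇒false (λ h → lookup x∉ (to (member-true xs) h) refl)
            | filter-all (λ y → ¬? (v ≟ y)) x∉
      = sym (ℚP.+-identityʳ (g v xs))
    ... | no v≢x
      rewrite ≢⇒≡ᵇ v≢x | ≢⇒≡ᵇ (v≢x ∘ sym)
      = sym (ℚP.+-identityˡ _)

  countVec-per : ∀ {n} k Rs xs → length Rs ≡ k → Unique xs → All (_< n) xs →
                 ℕtoℚ (countVec {n} k (fills Rs xs ∘ letters)) ≡ per (map indicator Rs) xs
  countVec-per zero    []       xs len u xs<n = refl
  countVec-per {n} (suc k) (R ∷ Rs) xs len u xs<n = begin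
    ℕtoℚ (sumFin n (λ v → countVec k (λ π → (member (toℕ v) xs ∧ R (toℕ v)) ∧ rest v π)))
      ≡⟨ ℕtoℚ-sumFin n _ ⟩
    sumℚ n (λ v → ℕtoℚ (countVec k (λ π → (member (toℕ v) xs ∧ R (toℕ v)) ∧ rest v π)))
      ≡⟨ sumℚ-cong n (λ v → guard (member (toℕ v) xs) (R (toℕ v)) v refl) ⟩
    sumℚ n (λ v → if member (toℕ v) xs then indicator R (toℕ v) * per (map indicator Rs) (remove (toℕ v) xs) else 0ℚ)
      ≡⟨ sumℚ-sel n (λ x ys → indicator R x * per (map indicator Rs) ys) xs u xs<n ⟩
    sel (λ x ys → indicator R x * per (map indicator Rs) ys) xs ∎
    where
    open ≡-Reasoning
    rest : Fin n → Vec (Fin n) k → Bool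
    rest v π = fills Rs (remove (toℕ v) xs) (letters π)
    ih : ∀ v → ℕtoℚ (countVec k (rest v)) ≡ per (map indicator Rs) (remove (toℕ v) xs)
    ih v = countVec-per k Rs (remove (toℕ v) xs) (ℕP.suc-injective len) (Unique.filter⁺ (λ y → ¬? (toℕ v ≟ y)) u)
      (tabulate (λ z∈ → lookup xs<n (proj₁ (∈-filter⁻ (λ y → ¬? (toℕ v ≟ y)) z∈))))
    guard : ∀ b c v → R (toℕ v) ≡ c → ℕtoℚ (countVec k (λ π → (b ∧ c) ∧ rest v π))
          ≡ (if b then indicator R (toℕ v) * per (map indicator Rs) (remove (toℕ v) xs) else 0ℚ)
    guard false c     v _  = cong ℕtoℚ (countVec-false k)
    guard true  true  v Rv rewrite Rv = ≡.trans (ih v) (sym (ℚP.*-identityˡ _))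
    guard true  false v Rv rewrite Rv = ≡.trans (cong ℕtoℚ (countVec-false k)) (sym (ℚP.*-zeroˡ (per (map indicator Rs) (remove (toℕ v) xs))))

open Counting

-- Poly-Bernoulli numbers and their differences as iterates of `𝒜` and `Δ𝒜`.

module PolyBernoulli where
  open import Data.Rational using (_+_; _*_; -_; _-_)

  sumTo-cong : ∀ n {f g} → (∀ j → j ≤ n → f j ≡ g j) → sumTo n f ≡ sumTo n g
  sumTo-cong zero    f≡g = f≡g 0 z≤n
  sumTo-cong (suc n) f≡g = cong₂ _+_ (sumTo-cong n (λ j j≤n → f≡g j (ℕP.m≤n⇒m≤1+n j≤n))) (f≡g (suc n) ℕP.≤-refl)

  sumTo-+ : ∀ n f g → sumTo n (λ j → f j + g j) ≡ sumTo n f + sumTo n g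
  sumTo-+ zero    f g = refl
  sumTo-+ (suc n) f g = ≡.trans (cong (_+ (f (suc n) + g (suc n))) (sumTo-+ n f g))
    (solve 4 (λ a b c d → (a :+ b) :+ (c :+ d) := (a :+ c) :+ (b :+ d)) refl (sumTo n f) (sumTo n g) (f (suc n)) (g (suc n)))

  sumTo-*ˡ : ∀ n c f → sumTo n (λ j → c * f j) ≡ c * sumTo n f
  sumTo-*ˡ zero    c f = refl
  sumTo-*ˡ (suc n) c f = ≡.trans (cong (_+ c * f (suc n)) (sumTo-*ˡ n c f)) (sym (ℚP.*-distribˡ-+ c (sumTo n f) (f (suc n))))

  sumTo-- : ∀ n f g → sumTo n (λ j → f j - g j) ≡ sumTo n f - sumTo n g
  sumTo-- zero    f g = refl
  sumTo-- (suc n) f g = ≡.trans (cong (_+ (f (suc n) - g (suc n))) (sumTo-- n f g))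
    (solve 4 (λ a b c d → (a :- b) :+ (c :- d) := (a :+ c) :- (b :+ d)) refl (sumTo n f) (sumTo n g) (f (suc n)) (g (suc n)))

  sumTo-shift : ∀ n f → sumTo (suc n) f ≡ f 0 + sumTo n (f ∘ suc)
  sumTo-shift zero    f = refl
  sumTo-shift (suc n) f = ≡.trans (cong (_+ f (suc (suc n))) (sumTo-shift n f)) (ℚP.+-assoc (f 0) (sumTo n (f ∘ suc)) (f (suc (suc n))))

  derivative : Series → Series
  derivative f n = ℕtoℚ (suc n) * f (suc n)

  ∸-suc : ∀ {j n} → j ≤ n → suc n ∸ j ≡ suc (n ∸ j)
  ∸-suc {j} {n} j≤n = ℕP.+-∸-assoc 1 j≤n

  -- Leibniz' rule: in each term the factor n + 1 splits as j + (n + 1 - j), the degrees of the two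
  -- coefficients.
  derivative-mulS : ∀ f g n → derivative (mulS f g) n ≡ mulS (derivative f) g n + mulS f (derivative g) n
  derivative-mulS f g n = begin
    ℕtoℚ (suc n) * sumTo (suc n) (λ j → f j * g (suc n ∸ j))       ≡⟨ sumTo-*ˡ (suc n) (ℕtoℚ (suc n)) _ ⟨
    sumTo (suc n) (λ j → ℕtoℚ (suc n) * (f j * g (suc n ∸ j)))     ≡⟨ sumTo-cong (suc n) split ⟩
    sumTo (suc n) (λ j → left j + right j)                         ≡⟨ sumTo-+ (suc n) left right ⟩
    sumTo (suc n) left + sumTo (suc n) right                       ≡⟨ cong₂ _+_ lefts rights ⟩
    mulS (derivative f) g n + mulS f (derivative g) n              ∎
    where
    open ≡-Reasoning
    left right : ℕ → ℚ
    left  j = ℕtoℚ j * f j * g (suc n ∸ j)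
    right j = f j * (ℕtoℚ (suc n ∸ j) * g (suc n ∸ j))
    split : ∀ j → j ≤ suc n → ℕtoℚ (suc n) * (f j * g (suc n ∸ j)) ≡ left j + right j
    split j j≤ = ≡.trans (cong (λ q → q * (f j * g (suc n ∸ j))) (≡.trans (cong ℕtoℚ (sym (ℕP.m+[n∸m]≡n j≤))) (ℕtoℚ-+ j (suc n ∸ j))))
      (solve 4 (λ a b x y → (a :+ b) :* (x :* y) := a :* x :* y :+ x :* (b :* y)) refl (ℕtoℚ j) (ℕtoℚ (suc n ∸ j)) (f j) (g (suc n ∸ j)))
    lefts : sumTo (suc n) left ≡ mulS (derivative f) g n
    lefts = ≡.trans (sumTo-shift n left) (≡.trans (cong (_+ sumTo n (left ∘ suc))
      (≡.trans (cong (_* g (suc n)) (ℚP.*-zeroˡ (f 0))) (ℚP.*-zeroˡ (g (suc n))))) (ℚP.+-identityˡ _))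
    rights : sumTo (suc n) right ≡ mulS f (derivative g) n
    rights = ≡.trans (cong₂ _+_ (sumTo-cong n (λ j j≤n → cong (λ l → f j * (ℕtoℚ l * g l)) (∸-suc j≤n))) last) (ℚP.+-identityʳ _)
      where
      last : right (suc n) ≡ 0ℚ
      last = ≡.trans (cong (λ l → f (suc n) * (ℕtoℚ l * g l)) (ℕP.n∸n≡0 n))
        (≡.trans (cong (f (suc n) *_) (ℚP.*-zeroˡ (g 0))) (ℚP.*-zeroʳ (f (suc n))))

  mulS-oneS : ∀ g n → mulS oneS g n ≡ g n
  mulS-oneS g zero    = ℚP.*-identityˡ (g 0)
  mulS-oneS g (suc n) = ≡.trans (sumTo-shift n _) (≡.trans (cong₂ _+_ (ℚP.*-identityˡ (g (suc n))) (zeros n (g ∘ (n ∸_)))) (ℚP.+-identityʳ _))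
    where
    zeros : ∀ m (h : ℕ → ℚ) → sumTo m (λ j → 0ℚ * h j) ≡ 0ℚ
    zeros m h = ≡.trans (sumTo-*ˡ m 0ℚ h) (ℚP.*-zeroˡ (sumTo m h))

  mulS--ˡ : ∀ f g h n → mulS (λ j → f j - g j) h n ≡ mulS f h n - mulS g h n
  mulS--ˡ f g h n = ≡.trans (sumTo-cong n (λ j _ → solve 3 (λ a b c → (a :- b) :* c := a :* c :- b :* c) refl (f j) (g j) (h (n ∸ j))))
    (sumTo-- n _ _)

  mulS-*--ʳ : ∀ c f g h n → mulS f (λ j → c * (g j - h j)) n ≡ c * (mulS f g n - mulS f h n)
  mulS-*--ʳ c f g h n = ≡.trans (sumTo-cong n (λ j _ → solve 4 (λ q a b d → a :* (q :* (b :- d)) := q :* (a :* b :- a :* d)) refl c (f j) (g (n ∸ j)) (h (n ∸ j))))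
    (≡.trans (sumTo-*ˡ n c _) (cong (c *_) (sumTo-- n _ _)))

  mulS-congˡ : ∀ {f g} h n → f ≗ g → mulS f h n ≡ mulS g h n
  mulS-congˡ h n f≗g = sumTo-cong n (λ j _ → cong (_* h (n ∸ j)) (f≗g j))

  mulS-congʳ : ∀ f {g h} n → g ≗ h → mulS f g n ≡ mulS f h n
  mulS-congʳ f n g≗h = sumTo-cong n (λ j _ → cong (f j *_) (g≗h (n ∸ j)))

  *-inverse : ∀ k {{_ : ℕ.NonZero k}} → ℕtoℚ k * (ℤ.+ 1 / k) ≡ 1ℚ
  *-inverse (suc k) = toℚᵘ-injective (begin
    toℚᵘ (ℕtoℚ (suc k) * (ℤ.+ 1 / suc k))              ≈⟨ toℚᵘ-homo-* (ℕtoℚ (suc k)) (ℤ.+ 1 / suc k) ⟩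
    toℚᵘ (ℕtoℚ (suc k)) ℚᵘ.* toℚᵘ (ℤ.+ 1 / suc k)      ≈⟨ ℚᵘP.*-cong (toℚᵘ-ℕtoℚ (suc k)) (toℚᵘ-fromℚᵘ (ℚᵘ.mkℚᵘ (ℤ.+ 1) k)) ⟩
    ℚᵘ.mkℚᵘ (ℤ.+ suc k) 0 ℚᵘ.* ℚᵘ.mkℚᵘ (ℤ.+ 1) k       ≈⟨ ℚᵘ.*≡* (≡.trans (ℤP.*-identityʳ _) (≡.trans (ℤP.*-identityʳ (ℤ.+ suc k)) (≡.trans (cong (ℤ.+_ ∘ suc) (sym (ℕP.+-identityʳ k))) (sym (ℤP.*-identityˡ _))))) ⟩
    ℚᵘ.mkℚᵘ (ℤ.+ 1) 0                                  ∎)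
    where open ℚᵘP.≃-Reasoning

  1/! : ℕ → ℚ
  1/! n = (ℤ.+ 1 / (n !)) {{ℕP._!≢0 n}}

  1/!-suc : ∀ n → ℕtoℚ (suc n) * 1/! (suc n) ≡ 1/! n
  1/!-suc n = begin
    ℕtoℚ (suc n) * 1/! (suc n)                              ≡⟨ ℚP.*-identityˡ _ ⟨
    1ℚ * (ℕtoℚ (suc n) * 1/! (suc n))                       ≡⟨ cong (_* (ℕtoℚ (suc n) * 1/! (suc n))) (*-inverse (n !) {{ℕP._!≢0 n}}) ⟨
    ℕtoℚ (n !) * 1/! n * (ℕtoℚ (suc n) * 1/! (suc n))       ≡⟨ solve 4 (λ a b c d → a :* b :* (c :* d) := b :* ((c :* a) :* d)) refl (ℕtoℚ (n !)) (1/! n) (ℕtoℚ (suc n)) (1/! (suc n)) ⟩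
    1/! n * (ℕtoℚ (suc n) * ℕtoℚ (n !) * 1/! (suc n))       ≡⟨ cong (λ q → 1/! n * (q * 1/! (suc n))) (ℕtoℚ-* (suc n) (n !)) ⟨
    1/! n * (ℕtoℚ (suc n !) * 1/! (suc n))                  ≡⟨ cong (1/! n *_) (*-inverse (suc n !) {{ℕP._!≢0 (suc n)}}) ⟩
    1/! n * 1ℚ                                              ≡⟨ ℚP.*-identityʳ _ ⟩
    1/! n                                                   ∎
    where open ≡-Reasoning

  derivative-oneMinusExpNeg : ∀ n → derivative oneMinusExpNeg n ≡ oneS n - oneMinusExpNeg n
  derivative-oneMinusExpNeg n = begin
    ℕtoℚ (suc n) * (0ℚ - (- signℚ n) * 1/! (suc n))  ≡⟨ cong (ℕtoℚ (suc n) *_) (ℚP.+-identityˡ _) ⟩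
    ℕtoℚ (suc n) * (- ((- signℚ n) * 1/! (suc n)))   ≡⟨ solve 3 (λ a s x → a :* (:- ((:- s) :* x)) := s :* (a :* x)) refl (ℕtoℚ (suc n)) (signℚ n) (1/! (suc n)) ⟩
    signℚ n * (ℕtoℚ (suc n) * 1/! (suc n))           ≡⟨ cong (signℚ n *_) (1/!-suc n) ⟩
    signℚ n * 1/! n                                  ≡⟨ solve 2 (λ o e → e := o :- (o :- e)) refl (oneS n) (expNeg n) ⟩
    oneS n - (oneS n - expNeg n)                     ∎
    where open ≡-Reasoning

  private
    E : Series
    E = oneMinusExpNeg

  -- The power rule, with (k + 1) Eᵏ E′ rewritten by E′ = 1 - E. Leibniz' rule gives one copy of Eᵏ
  -- - Eᵏ⁺¹ from the first factor and k copies from the second.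
  derivative-powS : ∀ k n → derivative (powS E (suc k)) n ≡ ℕtoℚ (suc k) * (powS E k n - powS E (suc k) n)
  derivative-powS k n = begin
    derivative (mulS E (powS E k)) n                                         ≡⟨ derivative-mulS E (powS E k) n ⟩
    mulS (derivative E) (powS E k) n + mulS E (derivative (powS E k)) n      ≡⟨ cong₂ _+_ first (second k) ⟩
    (powS E k n - powS E (suc k) n) + ℕtoℚ k * (powS E k n - powS E (suc k) n) ≡⟨ cong (_+ ℕtoℚ k * X) (ℚP.*-identityˡ X) ⟨
    1ℚ * X + ℕtoℚ k * X                                                      ≡⟨ ℚP.*-distribʳ-+ X 1ℚ (ℕtoℚ k) ⟨
    (1ℚ + ℕtoℚ k) * X                                                        ≡⟨ cong (_* X) (ℕtoℚ-suc k) ⟨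
    ℕtoℚ (suc k) * X                                                         ∎
    where
    open ≡-Reasoning
    X = powS E k n - powS E (suc k) n
    first : mulS (derivative E) (powS E k) n ≡ X
    first = ≡.trans (mulS-congˡ (powS E k) n derivative-oneMinusExpNeg)
      (≡.trans (mulS--ˡ oneS E (powS E k) n) (cong (_- powS E (suc k) n) (mulS-oneS (powS E k) n)))
    second : ∀ k → mulS E (derivative (powS E k)) n ≡ ℕtoℚ k * (powS E k n - powS E (suc k) n)
    -- The power 0 is the constant series, whose derivative vanishes.
    second zero    = ≡.trans (sumTo-cong n (λ j _ → ≡.trans (cong (E j *_) (ℚP.*-zeroʳ (ℕtoℚ (suc (n ∸ j))))) (≡.trans (ℚP.*-zeroʳ (E j)) (sym (ℚP.*-zeroˡ 0ℚ)))))
      (≡.trans (sumTo-*ˡ n 0ℚ (λ _ → 0ℚ)) (≡.trans (ℚP.*-zeroˡ (sumTo n (λ _ → 0ℚ))) (sym (ℚP.*-zeroˡ (powS E 0 n - powS E 1 n)))))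
    second (suc k) = ≡.trans (mulS-congʳ E n (derivative-powS k)) (mulS-*--ʳ (ℕtoℚ (suc k)) E (powS E k) (powS E (suc k)) n)

  -- This is n! [xⁿ] (1 - e⁻ˣ)ⁱ, the signed surjection number (-1)ⁿ⁺ⁱ i! S(n,i) with S a Stirling
  -- number of the second kind.
  coeff : ℕ → ℕ → ℚ
  coeff n i = ℕtoℚ (n !) * powS E i n

  coeff-suc : ∀ n i → coeff (suc n) (suc i) ≡ ℕtoℚ (suc i) * (coeff n i - coeff n (suc i))
  coeff-suc n i = begin
    ℕtoℚ (suc n !) * powS E (suc i) (suc n)                    ≡⟨ cong (_* powS E (suc i) (suc n)) (ℕtoℚ-* (suc n) (n !)) ⟩
    ℕtoℚ (suc n) * ℕtoℚ (n !) * powS E (suc i) (suc n)         ≡⟨ solve 3 (λ a b c → a :* b :* c := b :* (a :* c)) refl (ℕtoℚ (suc n)) (ℕtoℚ (n !)) (powS E (suc i) (suc n)) ⟩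
    ℕtoℚ (n !) * derivative (powS E (suc i)) n                 ≡⟨ cong (ℕtoℚ (n !) *_) (derivative-powS i n) ⟩
    ℕtoℚ (n !) * (ℕtoℚ (suc i) * (powS E i n - powS E (suc i) n)) ≡⟨ solve 4 (λ a b x y → a :* (b :* (x :- y)) := b :* (a :* x :- a :* y)) refl (ℕtoℚ (n !)) (ℕtoℚ (suc i)) (powS E i n) (powS E (suc i) n) ⟩
    ℕtoℚ (suc i) * (coeff n i - coeff n (suc i))               ∎
    where open ≡-Reasoning

  coeff-high : ∀ n i → n < i → coeff n i ≡ 0ℚ
  coeff-high zero    (suc i) _         = ≡.trans (ℚP.*-identityˡ (powS E (suc i) 0)) (ℚP.*-zeroˡ (powS E i 0))
  coeff-high (suc n) (suc i) (s≤s n<i) = ≡.trans (coeff-suc n i)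
    (≡.trans (cong₂ (λ a b → ℕtoℚ (suc i) * (a - b)) (coeff-high n i n<i) (coeff-high n (suc i) (ℕP.m≤n⇒m≤1+n n<i))) (ℚP.*-zeroʳ (ℕtoℚ (suc i))))

  fold-shift : ∀ {A : Set} (z : A) (s : A → A) n → fold (s z) s n ≡ s (fold z s n)
  fold-shift z s zero    = refl
  fold-shift z s (suc n) = cong s (fold-shift z s n)

  -- Summation by parts: the recursion `coeff-suc` is moved from the coefficients onto `F`, where it
  -- becomes `𝒜`. After n rounds only the coefficient of index 0 is left, and it is 1.
  sum-coeff : ∀ n F → sumTo n (λ i → F i * coeff n i) ≡ fold F 𝒜 n 0
  sum-coeff zero    F = ℚP.*-identityʳ (F 0)
  sum-coeff (suc n) F = begin
    sumTo (suc n) (λ i → F i * coeff (suc n) i)                   ≡⟨ sumTo-shift n _ ⟩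
    F 0 * coeff (suc n) 0 + sumTo n (λ i → F (suc i) * coeff (suc n) (suc i))
      ≡⟨ cong₂ _+_ (≡.trans (cong (F 0 *_) (ℚP.*-zeroʳ (ℕtoℚ (suc n !)))) (ℚP.*-zeroʳ (F 0))) (sumTo-cong n expand) ⟩
    0ℚ + sumTo n (λ i → ℕtoℚ (suc i) * F (suc i) * coeff n i - G (suc i))  ≡⟨ ℚP.+-identityˡ _ ⟩
    sumTo n (λ i → ℕtoℚ (suc i) * F (suc i) * coeff n i - G (suc i))       ≡⟨ sumTo-- n _ _ ⟩
    sumTo n (λ i → ℕtoℚ (suc i) * F (suc i) * coeff n i) - sumTo n (G ∘ suc) ≡⟨ cong (λ q → sumTo n (λ i → ℕtoℚ (suc i) * F (suc i) * coeff n i) - q) unshift ⟩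
    sumTo n (λ i → ℕtoℚ (suc i) * F (suc i) * coeff n i) - sumTo n G       ≡⟨ sumTo-- n _ _ ⟨
    sumTo n (λ i → ℕtoℚ (suc i) * F (suc i) * coeff n i - G i)             ≡⟨ sumTo-cong n (λ i _ → solve 3 (λ a b c → a :* c :- b :* c := (a :- b) :* c) refl (ℕtoℚ (suc i) * F (suc i)) (ℕtoℚ i * F i) (coeff n i)) ⟩
    sumTo n (λ i → 𝒜 F i * coeff n i)                                      ≡⟨ sum-coeff n (𝒜 F) ⟩
    fold (𝒜 F) 𝒜 n 0                                                       ≡⟨ cong (λ H → H 0) (fold-shift F 𝒜 n) ⟩
    fold F 𝒜 (suc n) 0                                                     ∎
    where
    open ≡-Reasoning
    G : ℕ → ℚ
    G i = ℕtoℚ i * F i * coeff n i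
    expand : ∀ i → i ≤ n → F (suc i) * coeff (suc n) (suc i) ≡ ℕtoℚ (suc i) * F (suc i) * coeff n i - G (suc i)
    expand i _ = ≡.trans (cong (F (suc i) *_) (coeff-suc n i))
      (solve 4 (λ f c x y → f :* (c :* (x :- y)) := c :* f :* x :- c :* f :* y) refl (F (suc i)) (ℕtoℚ (suc i)) (coeff n i) (coeff n (suc i)))
    -- Both boundary terms vanish: `G 0` has the factor 0, and `G (suc n)` contains a coefficient
    -- beyond the degree n.
    unshift : sumTo n (G ∘ suc) ≡ sumTo n G
    unshift = begin
      sumTo n (G ∘ suc)          ≡⟨ ℚP.+-identityˡ _ ⟨
      0ℚ + sumTo n (G ∘ suc)     ≡⟨ cong (_+ sumTo n (G ∘ suc)) (≡.trans (cong (_* coeff n 0) (ℚP.*-zeroˡ (F 0))) (ℚP.*-zeroˡ (coeff n 0))) ⟨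
      G 0 + sumTo n (G ∘ suc)    ≡⟨ sumTo-shift n G ⟨
      sumTo n G + G (suc n)      ≡⟨ cong (sumTo n G +_) (≡.trans (cong (ℕtoℚ (suc n) * F (suc n) *_) (coeff-high n (suc n) (ℕP.n<1+n n))) (ℚP.*-zeroʳ (ℕtoℚ (suc n) * F (suc n)))) ⟩
      sumTo n G + 0ℚ             ≡⟨ ℚP.+-identityʳ _ ⟩
      sumTo n G                  ∎

  weight : ℕ → ℕ → ℚ
  weight k i = ℕtoℚ (suc i ^ k)

  B-fold : ∀ n k → B n k ≡ fold (weight k) 𝒜 n 0
  B-fold n k = begin
    ℕtoℚ (n !) * sumTo n (λ i → weight k i * powS E i n)    ≡⟨ sumTo-*ˡ n (ℕtoℚ (n !)) _ ⟨
    sumTo n (λ i → ℕtoℚ (n !) * (weight k i * powS E i n))  ≡⟨ sumTo-cong n (λ i _ → solve 3 (λ a b c → a :* (b :* c) := b :* (a :* c)) refl (ℕtoℚ (n !)) (weight k i) (powS E i n)) ⟩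
    sumTo n (λ i → weight k i * coeff n i)                  ≡⟨ sum-coeff n (weight k) ⟩
    fold (weight k) 𝒜 n 0                                   ∎
    where open ≡-Reasoning

  -- Pascal's rule splits each later term of `full`: the part with `m C j` is the shifted
  -- difference, while the part with `m C suc j`, joined by the term of index 0, is the old
  -- difference with opposite sign.
  ΔB-suc : ∀ m a k → ΔB (suc m) a k ≡ ΔB m (suc a) k - ΔB m a k
  ΔB-suc m a k = begin
    sumTo (suc m) full                                     ≡⟨ sumTo-shift m full ⟩
    full 0 + sumTo m (full ∘ suc)                          ≡⟨ cong (full 0 +_) (≡.trans (sumTo-cong m pascal) (sumTo-+ m _ (h ∘ suc))) ⟩
    h 0 + (ΔB m (suc a) k + sumTo m (h ∘ suc))             ≡⟨ solve 3 (λ x y z → x :+ (y :+ z) := y :+ (x :+ z)) refl (h 0) (ΔB m (suc a) k) (sumTo m (h ∘ suc)) ⟩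
    ΔB m (suc a) k + (h 0 + sumTo m (h ∘ suc))             ≡⟨ cong (ΔB m (suc a) k +_) (sumTo-shift m h) ⟨
    ΔB m (suc a) k + sumTo (suc m) h                       ≡⟨ cong (ΔB m (suc a) k +_) tail ⟩
    ΔB m (suc a) k - ΔB m a k                              ∎
    where
    open ≡-Reasoning
    -- `h` combines the sign belonging to m + 1 with the binomial belonging to m. It agrees with
    -- `full` at 0 and vanishes at m + 1.
    full h : ℕ → ℚ
    full j = signℚ (suc m ∸ j) * ℕtoℚ (suc m C j) * B (a ℕ.+ j) k
    h    j = signℚ (suc m ∸ j) * ℕtoℚ (m C j) * B (a ℕ.+ j) k
    pascal : ∀ j → j ≤ m → full (suc j) ≡ signℚ (m ∸ j) * ℕtoℚ (m C j) * B (suc a ℕ.+ j) k + h (suc j)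
    pascal j _ = begin
      signℚ (m ∸ j) * ℕtoℚ (suc m C suc j) * B (a ℕ.+ suc j) k
        ≡⟨ cong (λ q → signℚ (m ∸ j) * q * B (a ℕ.+ suc j) k) (≡.trans (cong ℕtoℚ (sym (nCk+nC[k+1]≡[n+1]C[k+1] m j))) (ℕtoℚ-+ (m C j) (m C suc j))) ⟩
      signℚ (m ∸ j) * (ℕtoℚ (m C j) + ℕtoℚ (m C suc j)) * B (a ℕ.+ suc j) k
        ≡⟨ solve 4 (λ s x y b → s :* (x :+ y) :* b := s :* x :* b :+ s :* y :* b) refl (signℚ (m ∸ j)) (ℕtoℚ (m C j)) (ℕtoℚ (m C suc j)) (B (a ℕ.+ suc j) k) ⟩
      signℚ (m ∸ j) * ℕtoℚ (m C j) * B (a ℕ.+ suc j) k + h (suc j)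
        ≡⟨ cong (λ l → signℚ (m ∸ j) * ℕtoℚ (m C j) * B l k + h (suc j)) (ℕP.+-suc a j) ⟩
      signℚ (m ∸ j) * ℕtoℚ (m C j) * B (suc a ℕ.+ j) k + h (suc j) ∎
    tail : sumTo (suc m) h ≡ - ΔB m a k
    tail = begin
      sumTo m h + h (suc m)      ≡⟨ cong₂ _+_ (sumTo-cong m negated) (≡.trans (cong (λ c → signℚ (m ∸ m) * ℕtoℚ c * B (a ℕ.+ suc m) k) (k>n⇒nCk≡0 (ℕP.n<1+n m)))
                                      (≡.trans (cong (_* B (a ℕ.+ suc m) k) (ℚP.*-zeroʳ (signℚ (m ∸ m)))) (ℚP.*-zeroˡ (B (a ℕ.+ suc m) k)))) ⟩
      sumTo m (λ j → (- 1ℚ) * g j) + 0ℚ ≡⟨ ℚP.+-identityʳ _ ⟩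
      sumTo m (λ j → (- 1ℚ) * g j)      ≡⟨ sumTo-*ˡ m (- 1ℚ) g ⟩
      (- 1ℚ) * ΔB m a k                 ≡⟨ neg (ΔB m a k) ⟩
      - ΔB m a k                        ∎
      where
      g : ℕ → ℚ
      g j = signℚ (m ∸ j) * ℕtoℚ (m C j) * B (a ℕ.+ j) k
      neg : ∀ q → (- 1ℚ) * q ≡ - q
      neg q = ≡.trans (sym (ℚP.neg-distribˡ-* 1ℚ q)) (cong -_ (ℚP.*-identityˡ q))
      negated : ∀ j → j ≤ m → h j ≡ (- 1ℚ) * g j
      negated j j≤m = ≡.trans (cong (λ l → signℚ l * ℕtoℚ (m C j) * B (a ℕ.+ j) k) (∸-suc j≤m))
        (≡.trans (solve 3 (λ s c b → (:- s) :* c :* b := :- (s :* c :* b)) refl (signℚ (m ∸ j)) (ℕtoℚ (m C j)) (B (a ℕ.+ j) k)) (sym (neg (g j))))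

  Δ𝒜-- : ∀ m G H → fold (λ i → G i - H i) Δ𝒜 m ≗ (λ i → fold G Δ𝒜 m i - fold H Δ𝒜 m i)
  Δ𝒜-- zero    G H i = refl
  Δ𝒜-- (suc m) G H i = ≡.trans
    (cong₂ (λ x y → ℕtoℚ (suc i) * x - ℕtoℚ i * y - y) (Δ𝒜-- m G H (suc i)) (Δ𝒜-- m G H i))
    (solve 6 (λ c d g g′ h h′ → c :* (g′ :- h′) :- d :* (g :- h) :- (g :- h) := (c :* g′ :- d :* g :- g) :- (c :* h′ :- d :* h :- h)) refl
      (ℕtoℚ (suc i)) (ℕtoℚ i) (fold G Δ𝒜 m i) (fold G Δ𝒜 m (suc i)) (fold H Δ𝒜 m i) (fold H Δ𝒜 m (suc i)))

  -- Raising the first index of `B` applies `𝒜` once more to the weight. By linearity of `Δ𝒜` the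
  -- difference of two neighbours applies `𝒜` - 1, that is `Δ𝒜`, before the remaining iterations.
  ΔB-fold : ∀ m a k → ΔB m a k ≡ fold (fold (weight k) 𝒜 a) Δ𝒜 m 0
  ΔB-fold zero    a k = ≡.trans (ℚP.*-identityˡ (B (a ℕ.+ 0) k)) (≡.trans (cong (λ l → B l k) (ℕP.+-identityʳ a)) (B-fold a k))
  ΔB-fold (suc m) a k = begin
    ΔB (suc m) a k                                       ≡⟨ ΔB-suc m a k ⟩
    ΔB m (suc a) k - ΔB m a k                            ≡⟨ cong₂ _-_ (ΔB-fold m (suc a) k) (ΔB-fold m a k) ⟩
    fold (𝒜 F) Δ𝒜 m 0 - fold F Δ𝒜 m 0                    ≡⟨ Δ𝒜-- m (𝒜 F) F 0 ⟨
    fold (Δ𝒜 F) Δ𝒜 m 0                                   ≡⟨ cong (λ H → H 0) (fold-shift F Δ𝒜 m) ⟩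
    fold F Δ𝒜 (suc m) 0                                  ∎
    where
    open ≡-Reasoning
    F = fold (weight k) 𝒜 a

open PolyBernoulli

-- Arranging the rows by threshold and assembling the count.

open import Data.Nat using (_+_)
open import Data.Rational using (_*_)
open ℕP

applyUpTo-iterate : ∀ {A : Set} (F f : ℕ → A) n t → (∀ i → i < n → f i ≡ F (t + i)) → applyUpTo f n ≡ map F (iterate suc t n)
applyUpTo-iterate F f zero    t f≡F = refl
applyUpTo-iterate F f (suc n) t f≡F = cong₂ _∷_ (≡.trans (f≡F 0 (s≤s z≤n)) (cong F (+-identityʳ t)))
  (applyUpTo-iterate F (f ∘ suc) n (suc t) (λ i i<n → ≡.trans (f≡F (suc i) (s≤s i<n)) (cong F (+-suc t i))))

bottomRows-iterate : ∀ r a → bottomRows (suc r) (r + a) ≡ map atLeast (iterate suc 1 r) ++ map atLeast (iterate suc r a)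
bottomRows-iterate r a = ≡.trans (applyUpTo-+ _ r a) (cong₂ _++_
  (applyUpTo-iterate atLeast _ r 1 low) (applyUpTo-iterate atLeast _ a r high))
  where
  low : ∀ k → k < r → atLeast (threshold (suc r) k) ≡ atLeast (suc k)
  low k k<r rewrite <ᵇ-yes k<r = refl
  high : ∀ i → i < a → atLeast (threshold (suc r) (r + i)) ≡ atLeast (r + i)
  high i _ rewrite <ᵇ-no (≤⇒≯ (m≤m+n r i)) = refl

topRows-iterate : ∀ m p → reverse (topRows m p) ≡ map below (iterate suc (suc m) p)
topRows-iterate m p = ≡.trans (reverse-applyDownFrom _ p)
  (applyUpTo-iterate below _ p (suc m) (λ i _ → cong (below ∘ suc) (+-comm i m)))

-- A permanent ignores the order of its rows, so the window rows, which have the largest thresholds,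
-- can be put last for the greedy count. Here `r` is one less than the label of the added chip.
rows-↭ : ∀ r a p → rows (suc r) (r + a) p ↭
         (map atLeast (iterate suc 1 r) ++ map atLeast (iterate suc r a)) ++ map below (iterate suc (suc (r + a)) p)
rows-↭ r a p = begin
  top ʳ++ bottom             ↭⟨ ++↭ʳ++ top bottom ⟨
  top ++ bottom              ↭⟨ ++-comm top bottom ⟩
  bottom ++ top              ↭⟨ ++⁺ˡ bottom (↭-reverse top) ⟨
  bottom ++ reverse top      ≡⟨ cong₂ _++_ (bottomRows-iterate r a) (topRows-iterate (r + a) p) ⟩
  _                          ∎
  where
  open PermutationReasoning
  top = topRows (r + a) p
  bottom = bottomRows (suc r) (r + a)

remaining-upTo : ∀ n → Remaining n 0 0 (upTo n)
remaining-upTo n = remaining (λ t _ t≤n → ≡.trans (+-identityʳ _) (count-upTo t t≤n)) (≡.trans (+-identityʳ _) (length-upTo n))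
  where
  count-upTo : ∀ t → t ≤ n → count t (upTo n) ≡ t
  count-upTo t t≤n = begin
    length (filter (_<? t) (upTo n))                                         ≡⟨ cong (length ∘ filter (_<? t) ∘ upTo) (m+[n∸m]≡n t≤n) ⟨
    length (filter (_<? t) (upTo (t + (n ∸ t))))                             ≡⟨ cong (length ∘ filter (_<? t)) (applyUpTo-+ (λ i → i) t (n ∸ t)) ⟩
    length (filter (_<? t) (upTo t ++ applyUpTo (t +_) (n ∸ t)))             ≡⟨ cong length (filter-++ (_<? t) (upTo t) _) ⟩
    length (filter (_<? t) (upTo t) ++ filter (_<? t) (applyUpTo (t +_) (n ∸ t)))
      ≡⟨ cong₂ (λ xs ys → length (xs ++ ys)) (filter-all (_<? t) (tabulate ∈-upTo⁻))
               (filter-none (_<? t) (All.applyUpTo⁺₂ (t +_) (n ∸ t) (λ i → ≤⇒≯ (m≤m+n t i)))) ⟩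
    length (upTo t ++ [])                                                    ≡⟨ cong length (List.++-identityʳ (upTo t)) ⟩
    length (upTo t)                                                          ≡⟨ length-upTo t ⟩
    t                                                                        ∎
    where open ≡-Reasoning

per-rows : ∀ r a p → per (map indicator (rows (suc r) (r + a) p)) (upTo (r + a + p)) ≡ fold (fold (weight p) 𝒜 a) Δ𝒜 r 0
per-rows r a p = begin
  per (map indicator (rows (suc r) (r + a) p)) (upTo n)     ≡⟨ per-↭ (map⁺ indicator (rows-↭ r a p)) (upTo n) ⟩
  per (map indicator thresholds) (upTo n)                   ≡⟨ cong (λ fs → per fs (upTo n)) shape ⟩
  -- Nothing has been treated or postponed yet: the `[]` is `replicate 0 one`, and the factor is 0!
  -- = 1.
  per ((bottoms 1 r ++ bottoms r a ++ tops) ++ []) (upTo n) ≡⟨ Value.evaluate value 0 0 (upTo n) (remaining-upTo n) refl ⟩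
  ℕtoℚ 1 * fold (fold (weight p) 𝒜 a) Δ𝒜 r 0                ≡⟨ ℚP.*-identityˡ _ ⟩
  fold (fold (weight p) 𝒜 a) Δ𝒜 r 0                         ∎
  where
  open ≡-Reasoning
  n = r + a + p
  tops = map (indicator ∘ below) (iterate suc (suc (r + a)) p)
  thresholds = (map atLeast (iterate suc 1 r) ++ map atLeast (iterate suc r a)) ++ map below (iterate suc (suc (r + a)) p)
  shape : map indicator thresholds ≡ (bottoms 1 r ++ bottoms r a ++ tops) ++ []
  shape = begin
    map indicator ((low ++ high) ++ top)                             ≡⟨ map-++ indicator (low ++ high) top ⟩
    map indicator (low ++ high) ++ map indicator top                 ≡⟨ cong (_++ map indicator top) (map-++ indicator low high) ⟩
    (map indicator low ++ map indicator high) ++ map indicator top   ≡⟨ cong₂ _++_ (cong₂ _++_ (map-∘ (iterate suc 1 r)) (map-∘ (iterate suc r a))) (map-∘ (iterate suc (suc (r + a)) p)) ⟨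
    (bottoms 1 r ++ bottoms r a) ++ tops                             ≡⟨ ++-assoc (bottoms 1 r) (bottoms r a) tops ⟩
    bottoms 1 r ++ bottoms r a ++ tops                               ≡⟨ List.++-identityʳ _ ⟨
    (bottoms 1 r ++ bottoms r a ++ tops) ++ []                       ∎
    where
    low = map atLeast (iterate suc 1 r)
    high = map atLeast (iterate suc r a)
    top = map below (iterate suc (suc (r + a)) p)
  value : Value n 0 (bottoms 1 r ++ bottoms r a ++ tops) (fold (fold (weight p) 𝒜 a) Δ𝒜 r)
  value = Value-Δ𝒜 r 0 (≤-trans (m≤m+n r a) (m≤m+n (r + a) p))
    (Value-𝒜 a r (m≤m+n (r + a) p) (Value-below p (r + a) refl))

-- With r - 1, a = n - p + 1 - r and p - 1 as free parameters the inequalities of the theorem hold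
-- by construction and truncated subtraction disappears.
toppleable-count : ∀ r a p → let n = r + a + suc p in
  Σ[ N ∈ ℕ ]
    ((Σ[ π ∈ Vec (Fin n) n ] (isPerm π ≡ true × toppleable (suc r) (suc p) π ≡ true)) ↔ Fin N)
    × (ℕtoℚ N ≡ ΔB r a (suc p))
toppleable-count r a p = countVec n Q , countVec-↔ n Q ↔-∘ conjunction , (begin
  ℕtoℚ (countVec n Q)                                              ≡⟨ cong ℕtoℚ (countVec-cong n (toppleable-fills (r + a) p (suc r) (s≤s z≤n) (s≤s (m≤m+n r a)))) ⟩
  ℕtoℚ (countVec n (fills Rs (upTo n) ∘ letters))                  ≡⟨ countVec-per n Rs (upTo n) len (Unique.upTo⁺ n) (tabulate ∈-upTo⁻) ⟩
  per (map indicator Rs) (upTo n)                                  ≡⟨ per-rows r a (suc p) ⟩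
  fold (fold (weight (suc p)) 𝒜 a) Δ𝒜 r 0                          ≡⟨ ΔB-fold r a (suc p) ⟨
  ΔB r a (suc p)                                                   ∎)
  where
  open ≡-Reasoning
  n = r + a + suc p
  Rs = rows (suc r) (r + a) (suc p)
  Q : Vec (Fin n) n → Bool
  Q π = isPerm π ∧ toppleable (suc r) (suc p) π
  len : length Rs ≡ n
  len = ≡.trans (length-ʳ++ (topRows (r + a) (suc p))) (≡.trans (cong₂ _+_ (length-applyDownFrom _ (suc p)) (length-applyUpTo _ (r + a))) (+-comm (suc p) (r + a)))
  conjunction : (Σ[ π ∈ Vec (Fin n) n ] (isPerm π ≡ true × toppleable (suc r) (suc p) π ≡ true)) ↔ (Σ[ π ∈ Vec (Fin n) n ] Q π ≡ true)
  conjunction = mk↔ₛ′ (λ (π , x , y) → π , cong₂ _∧_ x y) (λ (π , z) → π , ∧-true z)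
    (λ (π , z) → cong (π ,_) (uip _ z)) (λ (π , x , y) → cong (π ,_) (cong₂ _,_ (uip _ x) (uip _ y)))

theorem2p6 : (n p r : ℕ) → 1 ≤ p → p ≤ n → 1 ≤ r → r ≤ n ∸ p + 1 →
    Σ[ N ∈ ℕ ]
    ((Σ[ π ∈ Vec (Fin n) n ] (isPerm π ≡ true × toppleable r p π ≡ true)) ↔ Fin N)
    × (ℕtoℚ N ≡ ΔB (r ∸ 1) (n ∸ p + 1 ∸ r) p)
theorem2p6 n (suc p) (suc r) _ p≤n _ r≤ =
  subst (λ n → Σ[ N ∈ ℕ ]
    ((Σ[ π ∈ Vec (Fin n) n ] (isPerm π ≡ true × toppleable (suc r) (suc p) π ≡ true)) ↔ Fin N)
    × (ℕtoℚ N ≡ ΔB r a (suc p))) n≡ (toppleable-count r a p)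
  where
  a = n ∸ suc p + 1 ∸ suc r
  n≡ : r + a + suc p ≡ n
  n≡ = begin
    r + (n ∸ suc p + 1 ∸ suc r) + suc p       ≡⟨ cong (λ m → r + (m ∸ suc r) + suc p) (+-comm (n ∸ suc p) 1) ⟩
    r + (n ∸ suc p ∸ r) + suc p               ≡⟨ cong (_+ suc p) (m+[n∸m]≡n (s≤s⁻¹ (≤-trans r≤ (≤-reflexive (+-comm (n ∸ suc p) 1))))) ⟩
    n ∸ suc p + suc p                         ≡⟨ m∸n+n≡m p≤n ⟩
    n                                         ∎
    where open ≡-Reasoning
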